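{- Let $0\le l<n$ be integers. The poset $R_{n,l}$ is rank-log-concave. It also admits a normalized flow, and hence is strongly Sperner.
   Context: $R_{n,l}$ is the poset whose elements are $(l+1)$-tuples $(A_1,\dots,A_{l+1})$ of nonempty subsets of $[n]=\{1,\dots,n\}$ such that $\max(A_i)<\min(A_{i+1})$ for all $i\in[l]$, ordered by componentwise containment. It is graded with ranks labeled $1$ to $n-l$, the rank of $(A_1,\dots,A_{l+1})$ being $|A_1\cup\cdots\cup A_{l+1}|-l$. For a finite graded poset $P$ with ranks labeled $1,\dots,d$, $W_r$ denotes the number of elements of rank $r$; $P$ is rank-log-concave if $W_{i-1}W_{i+1}\le W_i^2$ for $2\le i\le d-1$. $P$ is $j$-Sperner if for all antichains $A_1,\dots,A_j$ of $P$, $|A_1\cup\cdots\cup A_j|\le\max_{1\le r_1<\cdots<r_j\le d}(W_{r_1}+\cdots+W_{r_j})$; $P$ is strongly Sperner if it is $j$-Sperner for all $j\ge1$. A normalized flow on $P$ is a function $f$ from the cover relations of $P$ to $\mathbb{R}_{\ge0}$ such that for each $1\le r\le d-1$: (NF1) $\sum_{y:\,x\lessdot y}f(x\lessdot y)$ is the same positive number for all $x$ of rank $r$; and (NF2) $\sum_{x:\,x\lessdot y}f(x\lessdot y)$ is the same positive number for all $y$ of rank $r+1$. -}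

module Defs where

open import Data.Nat as ℕ using (ℕ; zero; suc; _+_; _*_; _∸_; _≤_; _<_)
open import Data.Nat.Properties as ℕP using ()
open import Data.Fin as Fin using (Fin; inject₁)
open import Data.Fin.Properties as FinP using (all?)
open import Data.Fin.Subset using (Subset; _∈_; _⊆_; Nonempty; ∣_∣; ⋃)
open import Data.Fin.Subset.Properties using (_∈?_; nonempty?)
open import Data.Bool using (Bool; true; false)
import Data.Bool.Properties as BoolP
open import Data.Vec as Vec using (Vec; []; _∷_; lookup)
import Data.Vec.Properties as VecP
open import Data.List as List using (List; []; _∷_; length; filter; concatMap; mapMaybe; deduplicate)
open import Data.List.Membership.Propositional as LMem using ()
open import Data.Maybe using (Maybe; just; nothing)
open import Data.Product using (Σ; ∃; _×_; _,_)
open import Data.Rational as ℚ using (ℚ; 0ℚ)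
open import Relation.Nullary using (¬_; Dec; yes; no)
open import Relation.Nullary.Decidable using (_×-dec_; _→-dec_)
open import Relation.Binary.PropositionalEquality using (_≡_)

-- Elements of R_{n,l}.
-- A subset of [n] = {1,…,n} is represented by a subset of Fin n
-- (Fin n ≅ {0,…,n-1}, the order-preserving relabelling i ↦ i+1).
-- The (l+1)-tuple (A_1,…,A_{l+1}) is a vector of length suc l.

MaxBelowMin : ∀ {n} → Subset n → Subset n → Set
MaxBelowMin {n} A B = ∀ (a b : Fin n) → a ∈ A → b ∈ B → a Fin.< b

Valid : ∀ n l → Vec (Subset n) (suc l) → Set
Valid n l As =
  (∀ (i : Fin (suc l)) → Nonempty (lookup As i)) ×
  (∀ (i : Fin l) → MaxBelowMin (lookup As (inject₁ i)) (lookup As (Fin.suc i)))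

valid? : ∀ n l (As : Vec (Subset n) (suc l)) → Dec (Valid n l As)
valid? n l As =
  all? (λ i → nonempty? (lookup As i)) ×-dec
  all? (λ i → all? (λ a → all? (λ b →
     (a ∈? lookup As (inject₁ i)) →-dec ((b ∈? lookup As (Fin.suc i)) →-dec (a Fin.<? b)))))

-- An element of R_{n,l}: the tuple together with an (irrelevant) proof
-- of validity, so elements are equal iff their tuples are equal.
record R (n l : ℕ) : Set where
  constructor mkR
  field
    tuple : Vec (Subset n) (suc l)
    .valid : Valid n l tuple
open R public

_≤R_ : ∀ {n l} → R n l → R n l → Set
x ≤R y = ∀ i → lookup (tuple x) i ⊆ lookup (tuple y) i

_<R_ : ∀ {n l} → R n l → R n l → Set
x <R y = x ≤R y × ¬ (tuple x ≡ tuple y)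

_⋖_ : ∀ {n l} → R n l → R n l → Set
x ⋖ y = x <R y × (∀ z → ¬ (x <R z × z <R y))

rank : ∀ {n l} → R n l → ℕ
rank {l = l} x = ∣ ⋃ (Vec.toList (tuple x)) ∣ ∸ l

-- Explicit enumeration of R_{n,l} (every element exactly once).

allSubsets : ∀ n → List (Subset n)
allSubsets zero = [] ∷ []
allSubsets (suc n) = concatMap (λ s → (true ∷ s) ∷ (false ∷ s) ∷ []) (allSubsets n)

allVecs : ∀ n k → List (Vec (Subset n) k)
allVecs n zero = [] ∷ []
allVecs n (suc k) = concatMap (λ v → List.map (_∷ v) (allSubsets n)) (allVecs n k)

toR : ∀ {n l} (As : Vec (Subset n) (suc l)) → Dec (Valid n l As) → Maybe (R n l)
toR As (yes p) = just (mkR As p)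
toR As (no _)  = nothing

elems : ∀ n l → List (R n l)
elems n l = mapMaybe (λ As → toR As (valid? n l As)) (allVecs n (suc l))

W : ∀ n l → ℕ → ℕ
W n l r = length (filter (λ x → rank x ℕ.≟ r) (elems n l))

-- ranks are labelled 1,…,d with d = n - l
d : ℕ → ℕ → ℕ
d n l = n ∸ l

RankLogConcave : ℕ → ℕ → Set
RankLogConcave n l = ∀ i → 2 ≤ i → i ≤ d n l ∸ 1 →
  W n l (i ∸ 1) * W n l (suc i) ≤ W n l i * W n l i

Antichain : ∀ {n l} → List (R n l) → Set
Antichain A = ∀ x y → x LMem.∈ A → y LMem.∈ A → x ≤R y → x ≡ y

unionSize : ∀ {n l j} → Vec (List (R n l)) j → ℕ
unionSize As = length (deduplicate (λ x y → VecP.≡-dec (VecP.≡-dec BoolP._≟_) (tuple x) (tuple y))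
                                   (List.concat (Vec.toList As)))

-- j-Sperner (meaningful for 1 ≤ j ≤ d, where the max ranges over a
-- nonempty set): the union of j antichains has size at most
-- W_{r_1}+⋯+W_{r_j} for some 1 ≤ r_1 < ⋯ < r_j ≤ d.
JSperner : ℕ → ℕ → ℕ → Set
JSperner n l j = (As : Vec (List (R n l)) j) → (∀ k → Antichain (lookup As k)) →
  Σ (Fin j → ℕ) λ r →
    (∀ k → 1 ≤ r k × r k ≤ d n l) ×
    (∀ a b → a Fin.< b → r a < r b) ×
    unionSize As ≤ Vec.sum (Vec.tabulate (λ k → W n l (r k)))

StronglySperner : ℕ → ℕ → Set
StronglySperner n l = ∀ j → 1 ≤ j → j ≤ d n l → JSperner n l j

sumℚ : ∀ {A : Set} → List A → (A → ℚ) → ℚ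
sumℚ xs g = List.foldr (λ x acc → g x ℚ.+ acc) 0ℚ xs

-- f is a function on the cover relations, represented as a function on
-- all pairs that vanishes off the cover relations.
IsNormalizedFlow : ∀ n l → (R n l → R n l → ℚ) → Set
IsNormalizedFlow n l f =
  (∀ x y → 0ℚ ℚ.≤ f x y) ×
  (∀ x y → ¬ (x ⋖ y) → f x y ≡ 0ℚ) ×
  (∀ r → 1 ≤ r → r ≤ d n l ∸ 1 →
     (Σ ℚ λ c → 0ℚ ℚ.< c × (∀ x → rank x ≡ r → sumℚ (elems n l) (λ y → f x y) ≡ c)) ×
     (Σ ℚ λ c → 0ℚ ℚ.< c × (∀ y → rank y ≡ suc r → sumℚ (elems n l) (λ x → f x y) ≡ c)))

HasNormalizedFlow : ℕ → ℕ → Set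
HasNormalizedFlow n l = Σ (R n l → R n l → ℚ) (IsNormalizedFlow n l)

{-# OPTIONS --safe #-}
-- Let S be the union of the parts of x. For e outside S and s in S, walk from e towards s: the first
-- element of S on the way decides which part e joins. Let f(x, y) be the number of pairs (e, s) that
-- turn x into y. For x of rank r, with m = r + l = |S|, the total outflow is (n − m) m. Conversely,
-- fix s in the union of y: e can be taken away again precisely when e is not the element of its part
-- nearest to s, which excludes one element per part; so the total inflow at y of rank r + 1 is
-- (m + 1) r. Hence f is a normalized flow. Double counting gives W_{r+1} (m + 1) r = W_r (n − m) m,
-- and log-concavity is the fact that (n − m) m / ((m + 1) r) decreases with r. For the Sperner
-- property, weigh saturated chains by products of f: the weight through an element of rank r is
-- inversely proportional to W_r, and a chain meets an antichain at most once. This is a LYM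
-- inequality, and under it j antichains fill at most the j largest ranks.
module Submission where

open import Defs
import Algebra.Properties.CommutativeSemigroup as CommutativeSemigroup
open import Data.Nat using (ℕ; zero; suc; _+_; _*_; _∸_; _≤_; _<_; _≟_; _≤?_; _<?_; ∣_-_∣; z≤n; s≤s; s≤s⁻¹; >-nonZero)
open import Data.Nat.Properties
open import Data.Nat.Coprimality as Coprimality using (1-coprimeTo)
open import Data.Nat.ListAction using (sum)
open import Data.Nat.ListAction.Properties using (sum-++)
open import Data.Nat.Solver using (module +-*-Solver)
open import Data.Integer as ℤ using ()
import Data.Integer.Properties as ℤ
open import Data.Rational as ℚ using (ℚ; 0ℚ; mkℚ)
open import Data.Rational.Properties as ℚ using (toℚᵘ-injective; toℚᵘ-homo-+)
open import Data.Rational.Unnormalised using (*≡*)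
import Data.Rational.Unnormalised.Properties as ℚᵘ
open import Data.Bool as Bool using (Bool; true; false; if_then_else_)
import Data.Bool.Properties as Bool
open import Data.Fin as Fin using (Fin; toℕ; fromℕ<; inject₁)
open import Data.Fin.Properties as Fin using (any?; all?; toℕ-inject₁; toℕ<n; toℕ-fromℕ<; toℕ-injective)
open import Data.Fin.Subset using (Subset; ∣_∣; _∈_; _∉_; ⋃; ⊥)
open import Data.Fin.Subset.Properties using (_∈?_; ∣⊥∣≡0; ⊆-antisym; drop-there; ∉⊥; x∈p∪q⁻; x∈p∪q⁺)
open import Data.Vec as Vec using (Vec; []; _∷_; lookup; _[_]≔_; there)
open import Data.Vec.Properties using (lookup-replicate; lookup∘update; lookup∘update′; []≔-idempotent; []≔-lookup; lookup⇒[]=; []=⇒lookup; tabulate∘lookup; tabulate-cong; ≡-dec)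
open import Data.List using (List; []; _∷_; _++_; _∷ʳ_; map; concat; concatMap; mapMaybe; filter; length; allFin; upTo; deduplicate)
open import Data.List.Properties using (map-cong; map-++; map-tabulate; upTo-∷ʳ; map-applyUpTo)
open import Data.List.Membership.Propositional using () renaming (_∈_ to _∈ˡ_)
import Data.List.Membership.DecPropositional as DecMembership
open import Data.List.Membership.Propositional.Properties using (∈-++⁻; ∈-deduplicate⁻)
import Data.List.Relation.Unary.All as All
open import Data.List.Relation.Unary.AllPairs as AllPairs using (AllPairs; []; _∷_)
import Data.List.Relation.Unary.Any as Any
open import Data.List.Relation.Unary.Unique.DecSetoid.Properties using (deduplicate-!)
open import Data.Maybe using (Maybe; just; nothing; maybe′)
open import Data.Product using (_×_; _,_; ∃; Σ; proj₁; proj₂)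
open import Data.Sum using (_⊎_; inj₁; inj₂; [_,_]′)
open import Function using (_∘_; id)
open import Relation.Nullary using (¬_; Dec; yes; no; contradiction)
open import Relation.Nullary.Decidable using (_×-dec_; _⊎-dec_; _→-dec_; ¬?; map′; recompute)
open import Relation.Nullary.Negation using (contradiction-irr)
open import Relation.Unary using (Decidable)
open import Relation.Binary.Bundles using (DecSetoid)
open import Relation.Binary.Definitions using (DecidableEquality; Reflexive; Transitive; Antisymmetric; tri<; tri≈; tri>)
import Relation.Binary.Construct.On as On
open import Relation.Binary.PropositionalEquality using (_≡_; _≢_; refl; sym; trans; cong; cong₂; subst; decSetoid; module ≡-Reasoning)

open +-*-Solver using (solve; _:+_; _:*_; _:=_; con)

-- Finite sums

private
  variable
    A B C : Set
    P Q : Set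

⟦_⟧ : Dec P → ℕ
⟦ yes _ ⟧ = 1
⟦ no _ ⟧ = 0

⟦⟧-yes : (P? : Dec P) → P → ⟦ P? ⟧ ≡ 1
⟦⟧-yes (yes _) p = refl
⟦⟧-yes (no ¬p) p = contradiction p ¬p

⟦⟧-no : (P? : Dec P) → ¬ P → ⟦ P? ⟧ ≡ 0
⟦⟧-no (yes p) ¬p = contradiction p ¬p
⟦⟧-no (no _) ¬p = refl

⟦⟧-¬ : (P? : Dec P) → ⟦ ¬? P? ⟧ + ⟦ P? ⟧ ≡ 1
⟦⟧-¬ (yes _) = refl
⟦⟧-¬ (no _) = refl

⟦⟧≤1 : (P? : Dec P) → ⟦ P? ⟧ ≤ 1
⟦⟧≤1 (yes _) = ≤-refl
⟦⟧≤1 (no _) = z≤n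

⟦⟧-mono : (P? : Dec P) (Q? : Dec Q) → (P → Q) → ⟦ P? ⟧ ≤ ⟦ Q? ⟧
⟦⟧-mono (no _) Q? f = z≤n
⟦⟧-mono (yes p) Q? f = ≤-reflexive (sym (⟦⟧-yes Q? (f p)))

⟦⟧-cong : (P? : Dec P) (Q? : Dec Q) → (P → Q) → (Q → P) → ⟦ P? ⟧ ≡ ⟦ Q? ⟧
⟦⟧-cong P? Q? f g = ≤-antisym (⟦⟧-mono P? Q? f) (⟦⟧-mono Q? P? g)

∑ : List A → (A → ℕ) → ℕ
∑ xs g = sum (map g xs)

∑-cong : ∀ (xs : List A) {g h : A → ℕ} → (∀ x → g x ≡ h x) → ∑ xs g ≡ ∑ xs h
∑-cong xs eq = cong sum (map-cong eq xs)

∑-mono : ∀ (xs : List A) {g h : A → ℕ} → (∀ x → g x ≤ h x) → ∑ xs g ≤ ∑ xs h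
∑-mono [] le = z≤n
∑-mono (x ∷ xs) le = +-mono-≤ (le x) (∑-mono xs le)

∑-zero : ∀ (xs : List A) {g : A → ℕ} → (∀ x → g x ≡ 0) → ∑ xs g ≡ 0
∑-zero [] eq = refl
∑-zero (x ∷ xs) eq = cong₂ _+_ (eq x) (∑-zero xs eq)

∑-++ : ∀ (xs ys : List A) (g : A → ℕ) → ∑ (xs ++ ys) g ≡ ∑ xs g + ∑ ys g
∑-++ xs ys g = trans (cong sum (map-++ g xs ys)) (sum-++ (map g xs) (map g ys))

∑-+ : ∀ (xs : List A) (g h : A → ℕ) → ∑ xs (λ x → g x + h x) ≡ ∑ xs g + ∑ xs h
∑-+ [] g h = refl
∑-+ (x ∷ xs) g h = trans (cong (g x + h x +_) (∑-+ xs g h)) (CommutativeSemigroup.interchange +-commutativeSemigroup (g x) (h x) (∑ xs g) (∑ xs h))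

∑-*ˡ : ∀ (xs : List A) c (g : A → ℕ) → ∑ xs (λ x → c * g x) ≡ c * ∑ xs g
∑-*ˡ [] c g = sym (*-zeroʳ c)
∑-*ˡ (x ∷ xs) c g = trans (cong (c * g x +_) (∑-*ˡ xs c g)) (sym (*-distribˡ-+ c (g x) (∑ xs g)))

∑-*ʳ : ∀ (xs : List A) c (g : A → ℕ) → ∑ xs (λ x → g x * c) ≡ ∑ xs g * c
∑-*ʳ xs c g = trans (∑-cong xs (λ x → *-comm (g x) c)) (trans (∑-*ˡ xs c g) (*-comm c (∑ xs g)))

∑-swap : ∀ (xs : List A) (ys : List B) (g : A → B → ℕ) →
  ∑ xs (λ x → ∑ ys (g x)) ≡ ∑ ys (λ y → ∑ xs (λ x → g x y))
∑-swap [] ys g = sym (∑-zero ys (λ _ → refl))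
∑-swap (x ∷ xs) ys g =
  trans (cong (∑ ys (g x) +_) (∑-swap xs ys g)) (sym (∑-+ ys (g x) (λ y → ∑ xs (λ x → g x y))))

∑-concatMap : ∀ (xs : List A) (k : A → List B) (g : B → ℕ) →
  ∑ (concatMap k xs) g ≡ ∑ xs (λ x → ∑ (k x) g)
∑-concatMap [] k g = refl
∑-concatMap (x ∷ xs) k g = trans (∑-++ (k x) (concatMap k xs) g) (cong (∑ (k x) g +_) (∑-concatMap xs k g))

∑-map : ∀ (xs : List A) (k : A → B) (g : B → ℕ) → ∑ (map k xs) g ≡ ∑ xs (g ∘ k)
∑-map [] k g = refl
∑-map (x ∷ xs) k g = cong (g (k x) +_) (∑-map xs k g)

∑-mapMaybe : ∀ (xs : List A) (k : A → Maybe B) (g : B → ℕ) →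
  ∑ (mapMaybe k xs) g ≡ ∑ xs (λ x → maybe′ g 0 (k x))
∑-mapMaybe [] k g = refl
∑-mapMaybe (x ∷ xs) k g with k x
... | just y = cong (g y +_) (∑-mapMaybe xs k g)
... | nothing = ∑-mapMaybe xs k g

length-filter : ∀ {P : A → Set} (P? : Decidable P) xs → length (filter P? xs) ≡ ∑ xs (λ x → ⟦ P? x ⟧)
length-filter P? [] = refl
length-filter P? (x ∷ xs) with P? x
... | yes _ = cong suc (length-filter P? xs)
... | no _ = length-filter P? xs

∑-upTo-suc : ∀ n (g : ℕ → ℕ) → ∑ (upTo (suc n)) g ≡ ∑ (upTo n) g + g n
∑-upTo-suc n g = begin
  ∑ (upTo (suc n)) g ≡⟨ cong (λ is → ∑ is g) (sym (upTo-∷ʳ n)) ⟩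
  ∑ (upTo n ∷ʳ n) g  ≡⟨ ∑-++ (upTo n) (n ∷ []) g ⟩
  ∑ (upTo n) g + (g n + 0) ≡⟨ cong (∑ (upTo n) g +_) (+-identityʳ (g n)) ⟩
  ∑ (upTo n) g + g n ∎
  where open ≡-Reasoning

∑-upTo-cong : ∀ n {g h : ℕ → ℕ} → (∀ i → i < n → g i ≡ h i) → ∑ (upTo n) g ≡ ∑ (upTo n) h
∑-upTo-cong zero eq = refl
∑-upTo-cong (suc n) {g} {h} eq = begin
  ∑ (upTo (suc n)) g ≡⟨ ∑-upTo-suc n g ⟩
  ∑ (upTo n) g + g n ≡⟨ cong₂ _+_ (∑-upTo-cong n (λ i i<n → eq i (m<n⇒m<1+n i<n))) (eq n (n<1+n n)) ⟩
  ∑ (upTo n) h + h n ≡⟨ sym (∑-upTo-suc n h) ⟩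
  ∑ (upTo (suc n)) h ∎
  where open ≡-Reasoning

∑-allFin-suc : ∀ n (g : Fin (suc n) → ℕ) → ∑ (allFin (suc n)) g ≡ g Fin.zero + ∑ (allFin n) (g ∘ Fin.suc)
∑-allFin-suc n g = cong (g Fin.zero +_) (trans (cong sum (map-tabulate Fin.suc g)) (cong sum (sym (map-tabulate id (g ∘ Fin.suc)))))

∑-upTo : ∀ n (g : ℕ → ℕ) → ∑ (upTo n) g ≡ ∑ (allFin n) (g ∘ Fin.toℕ)
∑-upTo zero g = refl
∑-upTo (suc n) g = trans
  (cong (g 0 +_) (trans (cong sum (map-applyUpTo suc g n)) (trans (cong sum (sym (map-applyUpTo id (g ∘ suc) n))) (∑-upTo n (g ∘ suc)))))
  (sym (∑-allFin-suc n (g ∘ Fin.toℕ)))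

-- A constructive way to say that a occurs exactly once in xs.
Once : List A → A → Set
Once {A} xs a = (g : A → ℕ) → (∀ x → x ≢ a → g x ≡ 0) → ∑ xs g ≡ g a

module _ {P : A → Set} (P? : Decidable P) where

  ∑-unique : ∀ xs {a} → Once xs a → P a → (∀ x → P x → x ≡ a) → ∑ xs (λ x → ⟦ P? x ⟧) ≡ 1
  ∑-unique _ {a} once pa uniq =
    trans (once _ (λ x x≢a → ⟦⟧-no (P? x) (x≢a ∘ uniq x))) (⟦⟧-yes (P? a) pa)

  ∑-none : ∀ xs → (∀ x → ¬ P x) → ∑ xs (λ x → ⟦ P? x ⟧) ≡ 0
  ∑-none xs none = ∑-zero xs (λ x → ⟦⟧-no (P? x) (none x))

-- Enumerations without repetition

allFin-once : ∀ {n} (i : Fin n) → Once (allFin n) i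
allFin-once {suc n} Fin.zero g vanish =
  trans (∑-allFin-suc n g) (trans (cong (g Fin.zero +_) (∑-zero (allFin n) (λ i → vanish (Fin.suc i) (λ ())))) (+-identityʳ _))
allFin-once {suc n} (Fin.suc i) g vanish =
  trans (∑-allFin-suc n g)
    (cong₂ _+_ (vanish Fin.zero (λ ())) (allFin-once i (g ∘ Fin.suc) (λ j j≢i → vanish (Fin.suc j) (λ { refl → j≢i refl }))))

allSubsets-once : ∀ {n} (p : Subset n) → Once (allSubsets n) p
allSubsets-once [] g vanish = +-identityʳ (g [])
allSubsets-once {suc n} (b ∷ p) g vanish =
  trans (∑-concatMap (allSubsets n) _ g)
    (trans (allSubsets-once p _ (λ q q≢p → cong₂ _+_ (off q q≢p) (cong (_+ 0) (off q q≢p)))) (at b vanish))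
  where
  off : ∀ q → q ≢ p → ∀ {c} → g (c ∷ q) ≡ 0
  off q q≢p = vanish _ (λ { refl → q≢p refl })
  at : ∀ b → (∀ q → q ≢ b ∷ p → g q ≡ 0) → g (true ∷ p) + (g (false ∷ p) + 0) ≡ g (b ∷ p)
  at true vanish = trans (cong (λ t → g (true ∷ p) + (t + 0)) (vanish _ (λ ()))) (+-identityʳ _)
  at false vanish = trans (cong (_+ (g (false ∷ p) + 0)) (vanish _ (λ ()))) (+-identityʳ _)

allVecs-once : ∀ {n k} (v : Vec (Subset n) k) → Once (allVecs n k) v
allVecs-once [] g vanish = +-identityʳ (g [])
allVecs-once {n} {suc k} (p ∷ v) g vanish =
  trans (∑-concatMap (allVecs n k) _ g)
    (trans (allVecs-once v _ (λ w w≢v → trans (∑-map (allSubsets n) (_∷ w) g) (∑-zero (allSubsets n) (λ q → vanish _ (λ { refl → w≢v refl })))))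
      (trans (∑-map (allSubsets n) (_∷ v) g) (allSubsets-once p _ (λ q q≢p → vanish _ (λ { refl → q≢p refl })))))

tuple-injective : ∀ {n l} {x y : R n l} → tuple x ≡ tuple y → x ≡ y
tuple-injective refl = refl

elems-once : ∀ {n l} (x : R n l) → Once (elems n l) x
elems-once {n} {l} x@(mkR _ v) g vanish =
  trans (∑-mapMaybe (allVecs n (suc l)) (λ As → toR As (valid? n l As)) g)
    (trans (allVecs-once (tuple x) _ (λ As As≢x → off As (valid? n l As) As≢x)) (at (valid? n l (tuple x))))
  where
  off : ∀ As (v? : Dec (Valid n l As)) → As ≢ tuple x → maybe′ g 0 (toR As v?) ≡ 0
  off As (yes p) As≢x = vanish (mkR As p) (As≢x ∘ cong tuple)
  off As (no _) As≢x = refl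
  at : ∀ (v? : Dec (Valid n l (tuple x))) → maybe′ g 0 (toR (tuple x) v?) ≡ g x
  -- Validity is an irrelevant field, so the proof found by `valid?` yields the same element as the
  -- one stored in `x`.
  at (yes p) = refl
  at (no ¬p) = contradiction-irr v ¬p

-- Selecting the largest levels

-- Descent on a bound `m` for the current value: every strictly better candidate lowers the bound,
-- so the search ends at a minimum.
minimiser : ∀ {n} {P : Fin n → Set} (P? : Decidable P) (μ : Fin n → ℕ) →
  ∃ P → ∃ λ i → P i × (∀ j → P j → μ i ≤ μ j)
minimiser {n} {P} P? μ (i , pi) = descend (μ i) i ≤-refl pi
  where
  descend : ∀ m i → μ i ≤ m → P i → ∃ λ i → P i × (∀ j → P j → μ i ≤ μ j)
  descend m i μi≤m pi with any? (λ j → P? j ×-dec (μ j <? μ i))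
  ... | no none = i , pi , λ j pj → ≮⇒≥ (λ lt → none (j , pj , lt))
  descend zero i μi≤m pi | yes (j , pj , lt) = contradiction (<-≤-trans lt μi≤m) (λ ())
  descend (suc m) i μi≤m pi | yes (j , pj , lt) = descend m j (s≤s⁻¹ (<-≤-trans lt μi≤m)) pj

unselected : ∀ {d} (v : Subset d) → ∣ v ∣ < d → ∃ λ i → lookup v i ≡ false
unselected (false ∷ v) lt = Fin.zero , refl
unselected (true ∷ v) lt with unselected v (s≤s⁻¹ lt)
... | i , eq = Fin.suc i , eq

∣[]≔true∣ : ∀ {d} (v : Subset d) i → lookup v i ≡ false → ∣ v [ i ]≔ true ∣ ≡ suc ∣ v ∣
∣[]≔true∣ (false ∷ v) Fin.zero eq = refl
∣[]≔true∣ (true ∷ v) (Fin.suc i) eq = cong suc (∣[]≔true∣ v i eq)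
∣[]≔true∣ (false ∷ v) (Fin.suc i) eq = ∣[]≔true∣ v i eq

-- Greedy choice: each step adds an unselected index of least cost. This cost becomes the new
-- threshold `τ`, which serves as a multiplier in `knapsack`.
select-smallest : ∀ {d} (c : Fin d → ℕ) → (∀ i → 1 ≤ c i) → ∀ j → j ≤ d →
  Σ (Subset d) λ v → Σ ℕ λ τ → ∣ v ∣ ≡ j × 1 ≤ τ ×
    (∀ i → lookup v i ≡ true → c i ≤ τ) × (∀ i → lookup v i ≡ false → τ ≤ c i)
select-smallest {d} c c≥1 zero _ =
  -- With nothing selected, 1 is a threshold because every cost is at least 1.
  ⊥ , 1 , ∣⊥∣≡0 d , ≤-refl ,
  (λ i eq → contradiction (trans (sym eq) (lookup-replicate i false)) (λ ())) , (λ i _ → c≥1 i)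
select-smallest {d} c c≥1 (suc j) j<d with select-smallest c c≥1 j (<⇒≤ j<d)
... | v , τ , refl , τ≥1 , below , above
  with minimiser (λ i → lookup v i Bool.≟ false) c (unselected v j<d)
... | i , vi , min = v [ i ]≔ true , c i , ∣[]≔true∣ v i vi , c≥1 i , below′ , above′
  where
  below′ : ∀ i′ → lookup (v [ i ]≔ true) i′ ≡ true → c i′ ≤ c i
  below′ i′ eq with i′ Fin.≟ i
  ... | yes refl = ≤-refl
  ... | no i′≢i = ≤-trans (below i′ (trans (sym (lookup∘update′ i′≢i v true)) eq)) (above i vi)
  above′ : ∀ i′ → lookup (v [ i ]≔ true) i′ ≡ false → c i ≤ c i′
  above′ i′ eq with i′ Fin.≟ i
  ... | yes refl = ≤-refl
  ... | no i′≢i = min i′ (trans (sym (lookup∘update′ i′≢i v true)) eq)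

-- The increasing enumeration of `v`. It turns a set of levels into the ranks r_1 < ... < r_j that
-- `JSperner` asks for.
select : ∀ {d} (v : Subset d) → Fin ∣ v ∣ → Fin d
select (true ∷ v) Fin.zero = Fin.zero
select (true ∷ v) (Fin.suc k) = Fin.suc (select v k)
select (false ∷ v) k = Fin.suc (select v k)

select-mono : ∀ {d} (v : Subset d) {k k′} → k Fin.< k′ → select v k Fin.< select v k′
select-mono (true ∷ v) {Fin.zero} {Fin.suc k′} lt = s≤s z≤n
select-mono (true ∷ v) {Fin.suc k} {Fin.suc k′} lt = s≤s (select-mono v (s≤s⁻¹ lt))
select-mono (false ∷ v) lt = s≤s (select-mono v lt)

restrict : ∀ {d} → Subset d → (Fin d → ℕ) → Fin d → ℕ
restrict v g i = if lookup v i then g i else 0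

∑-select : ∀ {d} (v : Subset d) (g : Fin d → ℕ) →
  Vec.sum (Vec.tabulate (λ k → g (select v k))) ≡ ∑ (allFin d) (restrict v g)
∑-select [] g = refl
∑-select (true ∷ v) g =
  trans (cong (g Fin.zero +_) (∑-select v (g ∘ Fin.suc))) (sym (∑-allFin-suc _ (restrict (true ∷ v) g)))
∑-select (false ∷ v) g = trans (∑-select v (g ∘ Fin.suc)) (sym (∑-allFin-suc _ (restrict (false ∷ v) g)))

∑-restrict-const : ∀ {d} (v : Subset d) N → ∑ (allFin d) (restrict v (λ _ → N)) ≡ ∣ v ∣ * N
∑-restrict-const [] N = refl
∑-restrict-const (true ∷ v) N = trans (∑-allFin-suc _ (restrict (true ∷ v) (λ _ → N))) (cong (N +_) (∑-restrict-const v N))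
∑-restrict-const (false ∷ v) N = trans (∑-allFin-suc _ (restrict (false ∷ v) (λ _ → N))) (∑-restrict-const v N)

-- This is (τ - c)(w - a) ≥ 0 with the negative terms moved to the other side.
rearrange : ∀ {c τ a w} → c ≤ τ → a ≤ w → τ * a + c * w ≤ τ * w + c * a
rearrange {c} {a = a} c≤τ a≤w with m≤n⇒∃[o]m+o≡n c≤τ | m≤n⇒∃[o]m+o≡n a≤w
... | p , refl | q , refl = subst ((c + p) * a + c * (a + q) ≤_) expand (m≤m+n _ (p * q))
  where
  expand : (c + p) * a + c * (a + q) + p * q ≡ (c + p) * (a + q) + c * a
  expand = solve 4 (λ c p a q → (c :+ p) :* a :+ c :* (a :+ q) :+ p :* q := (c :+ p) :* (a :+ q) :+ c :* a) refl c p a q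

-- A fractional knapsack: the a i are at most the w i, and the c i are inversely proportional to
-- the w i, so a linear budget on the a i is best spent on the largest w i.
knapsack : ∀ {d} (c a w : Fin d → ℕ) N j → j ≤ d → (∀ i → 1 ≤ c i) → (∀ i → a i ≤ w i) →
  (∀ i → c i * w i ≡ N) → ∑ (allFin d) (λ i → c i * a i) ≤ j * N →
  Σ (Subset d) λ v → ∣ v ∣ ≡ j × ∑ (allFin d) a ≤ ∑ (allFin d) (restrict v w)
knapsack {d} c a w N j j≤d c≥1 a≤w cw budget with select-smallest c c≥1 j j≤d
... | v , τ , refl , τ≥1 , below , above = v , refl , *-cancelˡ-≤ τ {{>-nonZero τ≥1}} scaled
  where
  chosen : Fin d → ℕ
  chosen = restrict v w
  -- On a selected index this is `rearrange` with `c i * w i` replaced by `N`; on an unselected one,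
  -- `τ ≤ c i`.
  pointwise : ∀ i → τ * a i + restrict v (λ _ → N) i ≤ τ * chosen i + c i * a i
  pointwise i with lookup v i in eq
  ... | true = subst (λ t → τ * a i + t ≤ τ * w i + c i * a i) (cw i) (rearrange (below i eq) (a≤w i))
  ... | false = begin
    τ * a i + 0 ≡⟨ +-identityʳ _ ⟩
    τ * a i ≤⟨ *-monoˡ-≤ (a i) (above i eq) ⟩
    c i * a i ≤⟨ m≤n+m _ (τ * 0) ⟩
    τ * 0 + c i * a i ∎
    where open ≤-Reasoning
  -- Summed up, the selected indices contribute `j * N` on the left, and the budget bounds the extra
  -- sum on the right by the same amount.
  scaled : τ * ∑ (allFin d) a ≤ τ * ∑ (allFin d) chosen
  scaled = +-cancelʳ-≤ (j * N) _ _ (begin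
    τ * ∑ (allFin d) a + j * N
      ≡⟨ cong₂ _+_ (sym (∑-*ˡ (allFin d) τ a)) (sym (∑-restrict-const v N)) ⟩
    ∑ (allFin d) (λ i → τ * a i) + ∑ (allFin d) (restrict v (λ _ → N))
      ≡⟨ sym (∑-+ (allFin d) _ _) ⟩
    ∑ (allFin d) (λ i → τ * a i + restrict v (λ _ → N) i)
      ≤⟨ ∑-mono (allFin d) pointwise ⟩
    ∑ (allFin d) (λ i → τ * chosen i + c i * a i)
      ≡⟨ ∑-+ (allFin d) _ _ ⟩
    ∑ (allFin d) (λ i → τ * chosen i) + ∑ (allFin d) (λ i → c i * a i)
      ≤⟨ +-mono-≤ (≤-reflexive (∑-*ˡ (allFin d) τ chosen)) budget ⟩
    τ * ∑ (allFin d) chosen + j * N ∎)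
    where open ≤-Reasoning

-- Uniform flows on graded posets

-- `out r` and `inn r` both belong to the step from rank `r` to rank `suc r`, hence `inn` is indexed
-- by the lower rank. Values in ℕ keep the double counting free of division.
record UniformFlow {X : Set} (elements : List X) (rk : X → ℕ) (_≼_ : X → X → Set)
                   (out inn : ℕ → ℕ) (f : X → X → ℕ) : Set where
  field
    support : ∀ x y → f x y ≡ 0 ⊎ (x ≼ y × x ≢ y × rk y ≡ suc (rk x))
    outflow : ∀ x → ∑ elements (f x) ≡ out (rk x)
    inflow  : ∀ {r} y → rk y ≡ suc r → ∑ elements (λ x → f x y) ≡ inn r

module FlowCounting {X : Set} {elements : List X} {rk : X → ℕ} {_≼_ : X → X → Set}
                    {out inn : ℕ → ℕ} {f : X → X → ℕ}
                    (flow : UniformFlow elements rk _≼_ out inn f) where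
  open UniformFlow flow

  level : ℕ → ℕ
  level r = ∑ elements (λ x → ⟦ rk x ≟ r ⟧)

  -- Nonzero flow joins consecutive ranks only, so the rank condition can be read at either end of
  -- an edge.
  shift : ∀ r x y → ⟦ rk x ≟ r ⟧ * f x y ≡ ⟦ rk y ≟ suc r ⟧ * f x y
  shift r x y with support x y
  ... | inj₁ eq rewrite eq = trans (*-zeroʳ ⟦ rk x ≟ r ⟧) (sym (*-zeroʳ ⟦ rk y ≟ suc r ⟧))
  ... | inj₂ (_ , _ , eq) = cong (_* f x y) (⟦⟧-cong (rk x ≟ r) (rk y ≟ suc r)
          (λ e → trans eq (cong suc e)) (λ e → suc-injective (trans (sym eq) e)))

  outflow-at : ∀ r x → ⟦ rk x ≟ r ⟧ * ∑ elements (f x) ≡ ⟦ rk x ≟ r ⟧ * out r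
  outflow-at r x with rk x ≟ r
  ... | yes refl = cong (_+ 0) (outflow x)
  ... | no _ = refl

  inflow-at : ∀ r y → ⟦ rk y ≟ suc r ⟧ * ∑ elements (λ x → f x y) ≡ ⟦ rk y ≟ suc r ⟧ * inn r
  inflow-at r y with rk y ≟ suc r
  ... | yes eq = cong (_+ 0) (inflow y eq)
  ... | no _ = refl

  -- After exchanging the sums, each `x` of rank `r` passes its weight `g x` upwards `out r` times
  -- in total. `balance` takes `g` constant, the LYM recursion takes `meeting`.
  push : ∀ r (g : X → ℕ) →
    ∑ elements (λ y → ⟦ rk y ≟ suc r ⟧ * ∑ elements (λ x → f x y * g x)) ≡
    out r * ∑ elements (λ x → ⟦ rk x ≟ r ⟧ * g x)
  push r g = begin
    ∑ elements (λ y → ⟦ rk y ≟ suc r ⟧ * ∑ elements (λ x → f x y * g x))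
      ≡⟨ ∑-cong elements (λ y → sym (∑-*ˡ elements ⟦ rk y ≟ suc r ⟧ _)) ⟩
    ∑ elements (λ y → ∑ elements (λ x → ⟦ rk y ≟ suc r ⟧ * (f x y * g x)))
      ≡⟨ ∑-swap elements elements _ ⟩
    ∑ elements (λ x → ∑ elements (λ y → ⟦ rk y ≟ suc r ⟧ * (f x y * g x)))
      ≡⟨ ∑-cong elements (λ x → ∑-cong elements (λ y → regroup x y)) ⟩
    ∑ elements (λ x → ∑ elements (λ y → ⟦ rk x ≟ r ⟧ * g x * f x y))
      ≡⟨ ∑-cong elements (λ x → ∑-*ˡ elements (⟦ rk x ≟ r ⟧ * g x) (f x)) ⟩
    ∑ elements (λ x → ⟦ rk x ≟ r ⟧ * g x * ∑ elements (f x))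
      ≡⟨ ∑-cong elements (λ x → total x) ⟩
    ∑ elements (λ x → out r * (⟦ rk x ≟ r ⟧ * g x))
      ≡⟨ ∑-*ˡ elements (out r) _ ⟩
    out r * ∑ elements (λ x → ⟦ rk x ≟ r ⟧ * g x) ∎
    where
    open ≡-Reasoning
    exchange : ∀ a b c → a * b * c ≡ a * c * b
    exchange a b c = trans (*-assoc a b c) (trans (cong (a *_) (*-comm b c)) (sym (*-assoc a c b)))
    regroup : ∀ x y → ⟦ rk y ≟ suc r ⟧ * (f x y * g x) ≡ ⟦ rk x ≟ r ⟧ * g x * f x y
    regroup x y = begin
      ⟦ rk y ≟ suc r ⟧ * (f x y * g x) ≡⟨ sym (*-assoc ⟦ rk y ≟ suc r ⟧ (f x y) (g x)) ⟩
      ⟦ rk y ≟ suc r ⟧ * f x y * g x ≡⟨ cong (_* g x) (sym (shift r x y)) ⟩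
      ⟦ rk x ≟ r ⟧ * f x y * g x ≡⟨ exchange ⟦ rk x ≟ r ⟧ (f x y) (g x) ⟩
      ⟦ rk x ≟ r ⟧ * g x * f x y ∎
    total : ∀ x → ⟦ rk x ≟ r ⟧ * g x * ∑ elements (f x) ≡ out r * (⟦ rk x ≟ r ⟧ * g x)
    total x = begin
      ⟦ rk x ≟ r ⟧ * g x * ∑ elements (f x) ≡⟨ exchange ⟦ rk x ≟ r ⟧ (g x) _ ⟩
      ⟦ rk x ≟ r ⟧ * ∑ elements (f x) * g x ≡⟨ cong (_* g x) (outflow-at r x) ⟩
      ⟦ rk x ≟ r ⟧ * out r * g x ≡⟨ exchange ⟦ rk x ≟ r ⟧ (out r) (g x) ⟩
      ⟦ rk x ≟ r ⟧ * g x * out r ≡⟨ *-comm _ (out r) ⟩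
      out r * (⟦ rk x ≟ r ⟧ * g x) ∎

  -- The total flow between two consecutive ranks, counted at its upper and at its lower end.
  balance : ∀ r → level (suc r) * inn r ≡ out r * level r
  balance r = begin
    level (suc r) * inn r
      ≡⟨ sym (∑-*ʳ elements (inn r) _) ⟩
    ∑ elements (λ y → ⟦ rk y ≟ suc r ⟧ * inn r)
      ≡⟨ ∑-cong elements (λ y → sym (inflow-at r y)) ⟩
    ∑ elements (λ y → ⟦ rk y ≟ suc r ⟧ * ∑ elements (λ x → f x y))
      ≡⟨ ∑-cong elements (λ y → cong (⟦ rk y ≟ suc r ⟧ *_) (∑-cong elements (λ x → sym (*-identityʳ (f x y))))) ⟩
    ∑ elements (λ y → ⟦ rk y ≟ suc r ⟧ * ∑ elements (λ x → f x y * 1))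
      ≡⟨ push r (λ _ → 1) ⟩
    out r * ∑ elements (λ x → ⟦ rk x ≟ r ⟧ * 1)
      ≡⟨ cong (out r *_) (∑-cong elements (λ x → *-identityʳ ⟦ rk x ≟ r ⟧)) ⟩
    out r * level r ∎
    where open ≡-Reasoning

  -- By `balance`, the quotient of consecutive level sizes is `out r` over `inn r`; the last
  -- hypothesis says, without fractions, that this quotient does not increase.
  logConcave-at : ∀ r → 0 < out r → 0 < inn (suc r) → inn r * out (suc r) ≤ out r * inn (suc r) →
    level r * level (suc (suc r)) ≤ level (suc r) * level (suc r)
  logConcave-at r out>0 inn>0 le = *-cancelˡ-≤ (out r * inn (suc r)) {{m*n≢0 _ _ {{>-nonZero out>0}} {{>-nonZero inn>0}}}} (begin
    out r * inn (suc r) * (level r * level (2 + r))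
      ≡⟨ cross (out r) (inn (suc r)) (level r) (level (2 + r)) ⟩
    out r * level r * (level (2 + r) * inn (suc r))
      ≡⟨ cong₂ _*_ (sym (balance r)) (balance (suc r)) ⟩
    level (suc r) * inn r * (out (suc r) * level (suc r))
      ≡⟨ cross′ (level (suc r)) (inn r) (out (suc r)) ⟩
    inn r * out (suc r) * (level (suc r) * level (suc r))
      ≤⟨ *-monoˡ-≤ _ le ⟩
    out r * inn (suc r) * (level (suc r) * level (suc r)) ∎)
    where
    open ≤-Reasoning
    cross : ∀ o i a b → o * i * (a * b) ≡ o * a * (b * i)
    cross = solve 4 (λ o i a b → o :* i :* (a :* b) := o :* a :* (b :* i)) refl
    cross′ : ∀ a i o → a * i * (o * a) ≡ i * o * (a * a)
    cross′ = solve 3 (λ a i o → a :* i :* (o :* a) := i :* o :* (a :* a)) refl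

  -- Weight of the saturated chains from rank 1 to an element of rank k + 1.
  chainsBelow : ℕ → ℕ
  chainsBelow zero = 1
  chainsBelow (suc k) = inn (suc k) * chainsBelow k

  -- Weight of the saturated chains from rank 1 to rank k + 1 through an element of rank i + 1.
  coefficient : ℕ → ℕ → ℕ
  coefficient zero i = 1
  coefficient (suc k) i with i ≤? k
  ... | yes _ = out (suc k) * coefficient k i
  ... | no _ = chainsBelow (suc k)

  coefficient-old : ∀ {k i} → i ≤ k → coefficient (suc k) i ≡ out (suc k) * coefficient k i
  coefficient-old {k} {i} i≤k with i ≤? k
  ... | yes _ = refl
  ... | no i≰k = contradiction i≤k i≰k

  coefficient-new : ∀ k → coefficient (suc k) (suc k) ≡ chainsBelow (suc k)
  coefficient-new k with suc k ≤? k
  ... | yes k<k = contradiction k<k (n≮n k)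
  ... | no _ = refl

  -- A saturated chain from rank 1 to rank `suc k` has exactly one element of rank `suc i`, so both
  -- sides are the total weight of these chains.
  coefficient-level : ∀ k i → i ≤ k → coefficient k i * level (suc i) ≡ chainsBelow k * level (suc k)
  coefficient-level zero .zero z≤n = refl
  coefficient-level (suc k) i i≤1+k with m≤n⇒m<n∨m≡n i≤1+k
  ... | inj₂ refl = cong (_* level (2 + k)) (coefficient-new k)
  ... | inj₁ (s≤s i≤k) = begin
    coefficient (suc k) i * level (suc i) ≡⟨ cong (_* level (suc i)) (coefficient-old i≤k) ⟩
    out (suc k) * coefficient k i * level (suc i) ≡⟨ *-assoc (out (suc k)) _ _ ⟩
    out (suc k) * (coefficient k i * level (suc i)) ≡⟨ cong (out (suc k) *_) (coefficient-level k i i≤k) ⟩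
    out (suc k) * (chainsBelow k * level (suc k)) ≡⟨ swap₁ (out (suc k)) (chainsBelow k) (level (suc k)) ⟩
    chainsBelow k * (out (suc k) * level (suc k)) ≡⟨ cong (chainsBelow k *_) (sym (balance (suc k))) ⟩
    chainsBelow k * (level (2 + k) * inn (suc k)) ≡⟨ swap₂ (chainsBelow k) (level (2 + k)) (inn (suc k)) ⟩
    chainsBelow (suc k) * level (2 + k) ∎
    where
    open ≡-Reasoning
    swap₁ : ∀ a b c → a * (b * c) ≡ b * (a * c)
    swap₁ = solve 3 (λ a b c → a :* (b :* c) := b :* (a :* c)) refl
    swap₂ : ∀ a b c → a * (b * c) ≡ c * a * b
    swap₂ = solve 3 (λ a b c → a :* (b :* c) := c :* a :* b) refl

  module _ (inn>0 : ∀ r → 1 ≤ r → 0 < inn r) where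

    chainsBelow>0 : ∀ k → 0 < chainsBelow k
    chainsBelow>0 zero = s≤s z≤n
    chainsBelow>0 (suc k) = *-mono-≤ (inn>0 (suc k) (s≤s z≤n)) (chainsBelow>0 k)

    -- Positivity of `out` is asked up to `k` only: in the application `suc k` is the top rank,
    -- where the outflow vanishes.
    coefficient>0 : ∀ k i → i ≤ k → (∀ r → 1 ≤ r → r ≤ k → 0 < out r) → 0 < coefficient k i
    coefficient>0 zero i i≤k out>0 = s≤s z≤n
    coefficient>0 (suc k) i i≤k out>0 with i ≤? k
    ... | yes i≤k = *-mono-≤ (out>0 (suc k) (s≤s z≤n) ≤-refl)
                      (coefficient>0 k i i≤k (λ r r≥1 r≤k → out>0 r r≥1 (m≤n⇒m≤1+n r≤k)))
    ... | no _ = chainsBelow>0 (suc k)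

  -- The LYM inequality for one antichain

  levelIn : {F : X → Set} → Decidable F → ℕ → ℕ
  levelIn F? r = ∑ elements (λ x → ⟦ rk x ≟ r ⟧ * ⟦ F? x ⟧)

  levelIn≤level : ∀ {F : X → Set} (F? : Decidable F) r → levelIn F? r ≤ level r
  levelIn≤level F? r = ∑-mono elements (λ x →
    subst (⟦ rk x ≟ r ⟧ * ⟦ F? x ⟧ ≤_) (*-identityʳ _) (*-monoʳ-≤ ⟦ rk x ≟ r ⟧ (⟦⟧≤1 (F? x))))

  module LYM (≼-refl : Reflexive _≼_) (≼-trans : Transitive _≼_) (≼-antisym : Antisymmetric _≡_ _≼_)
             {A : X → Set} (A? : Decidable A) (antichain : ∀ x y → A x → A y → x ≼ y → x ≡ y) where

    -- Total weight of the saturated chains from rank 1 to y that meet A; the sum over the lower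
    -- covers does not overcount, because a chain meets A at most once.
    meeting : ℕ → X → ℕ
    meeting zero y = ⟦ A? y ⟧
    meeting (suc k) y = chainsBelow (suc k) * ⟦ A? y ⟧ + ∑ elements (λ x → f x y * meeting k x)

    meeting-none : ∀ k y → (∀ z → A z → ¬ (z ≼ y)) → meeting k y ≡ 0
    meeting-none zero y none = ⟦⟧-no (A? y) (λ ay → none y ay ≼-refl)
    meeting-none (suc k) y none = cong₂ _+_
      (trans (cong (chainsBelow (suc k) *_) (⟦⟧-no (A? y) (λ ay → none y ay ≼-refl))) (*-zeroʳ (chainsBelow (suc k))))
      (∑-zero elements vanish)
      where
      vanish : ∀ x → f x y * meeting k x ≡ 0
      vanish x with support x y
      ... | inj₁ eq = cong (_* meeting k x) eq
      ... | inj₂ (x≼y , _) =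
        trans (cong (f x y *_) (meeting-none k x (λ z az z≼x → none z az (≼-trans z≼x x≼y)))) (*-zeroʳ (f x y))

    -- If `y` lies in the antichain, nothing strictly below it does, and only the first summand
    -- survives. Otherwise that summand vanishes, and the bound for the lower covers combines with
    -- the inflow.
    meeting≤ : ∀ k y → rk y ≡ suc k → meeting k y ≤ chainsBelow k
    meeting≤ zero y _ = ⟦⟧≤1 (A? y)
    meeting≤ (suc k) y rky with A? y
    ... | yes ay = ≤-reflexive (trans (cong₂ _+_ (*-identityʳ (chainsBelow (suc k))) (∑-zero elements vanish)) (+-identityʳ _))
      where
      vanish : ∀ x → f x y * meeting k x ≡ 0
      vanish x with support x y
      ... | inj₁ eq = cong (_* meeting k x) eq
      ... | inj₂ (x≼y , x≢y , _) =
        trans (cong (f x y *_) (meeting-none k x (λ z az z≼x → below z az z≼x))) (*-zeroʳ (f x y))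
        where
        below : ∀ z → A z → ¬ (z ≼ x)
        -- A member below `x` would also be below `y`, hence equal to `y`, and then `x` and `y`
        -- would lie below each other.
        below z az z≼x with antichain z y az ay (≼-trans z≼x x≼y)
        ... | refl = x≢y (≼-antisym x≼y z≼x)
    ... | no _ = begin
      chainsBelow (suc k) * 0 + ∑ elements (λ x → f x y * meeting k x)
        ≡⟨ cong (_+ ∑ elements (λ x → f x y * meeting k x)) (*-zeroʳ (chainsBelow (suc k))) ⟩
      ∑ elements (λ x → f x y * meeting k x)
        ≤⟨ ∑-mono elements bound ⟩
      ∑ elements (λ x → f x y * chainsBelow k)
        ≡⟨ ∑-*ʳ elements (chainsBelow k) (λ x → f x y) ⟩
      ∑ elements (λ x → f x y) * chainsBelow k
        ≡⟨ cong (_* chainsBelow k) (inflow y rky) ⟩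
      chainsBelow (suc k) ∎
      where
      open ≤-Reasoning
      bound : ∀ x → f x y * meeting k x ≤ f x y * chainsBelow k
      bound x with support x y
      ... | inj₁ eq rewrite eq = z≤n
      ... | inj₂ (_ , _ , eq) = *-monoʳ-≤ (f x y) (meeting≤ k x (suc-injective (trans (sym eq) rky)))

    total : ℕ → ℕ
    total k = ∑ elements (λ y → ⟦ rk y ≟ suc k ⟧ * meeting k y)

    total≤ : ∀ k → total k ≤ chainsBelow k * level (suc k)
    total≤ k = ≤-trans (∑-mono elements bound) (≤-reflexive (∑-*ˡ elements (chainsBelow k) _))
      where
      bound : ∀ y → ⟦ rk y ≟ suc k ⟧ * meeting k y ≤ chainsBelow k * ⟦ rk y ≟ suc k ⟧
      bound y with rk y ≟ suc k
      ... | yes eq = ≤-trans (≤-reflexive (+-identityʳ _)) (≤-trans (meeting≤ k y eq) (≤-reflexive (sym (*-identityʳ _))))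
      ... | no _ = z≤n

    total-suc : ∀ k → total (suc k) ≡ out (suc k) * total k + chainsBelow (suc k) * levelIn A? (2 + k)
    total-suc k = begin
      total (suc k)
        ≡⟨ ∑-cong elements (λ y → distrib ⟦ rk y ≟ 2 + k ⟧ (chainsBelow (suc k)) ⟦ A? y ⟧ (sums y)) ⟩
      ∑ elements (λ y → chainsBelow (suc k) * (⟦ rk y ≟ 2 + k ⟧ * ⟦ A? y ⟧) + ⟦ rk y ≟ 2 + k ⟧ * sums y)
        ≡⟨ ∑-+ elements _ _ ⟩
      ∑ elements (λ y → chainsBelow (suc k) * (⟦ rk y ≟ 2 + k ⟧ * ⟦ A? y ⟧)) + ∑ elements (λ y → ⟦ rk y ≟ 2 + k ⟧ * sums y)
        ≡⟨ cong₂ _+_ (∑-*ˡ elements (chainsBelow (suc k)) _) (push (suc k) (meeting k)) ⟩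
      chainsBelow (suc k) * levelIn A? (2 + k) + out (suc k) * total k
        ≡⟨ +-comm _ (out (suc k) * total k) ⟩
      out (suc k) * total k + chainsBelow (suc k) * levelIn A? (2 + k) ∎
      where
      open ≡-Reasoning
      sums : X → ℕ
      sums y = ∑ elements (λ x → f x y * meeting k x)
      distrib : ∀ i c a s → i * (c * a + s) ≡ c * (i * a) + i * s
      distrib = solve 4 (λ i c a s → i :* (c :* a :+ s) := c :* (i :* a) :+ i :* s) refl

    -- Unrolling `total-suc` sorts the chains that meet the antichain by the rank at which they meet
    -- it.
    total-levels : ∀ k → total k ≡ ∑ (upTo (suc k)) (λ i → coefficient k i * levelIn A? (suc i))
    total-levels zero = sym (trans (+-identityʳ _) (+-identityʳ _))
    total-levels (suc k) = sym (begin
      ∑ (upTo (2 + k)) (λ i → coefficient (suc k) i * levelIn A? (suc i))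
        ≡⟨ ∑-upTo-suc (suc k) (λ i → coefficient (suc k) i * levelIn A? (suc i)) ⟩
      ∑ (upTo (suc k)) (λ i → coefficient (suc k) i * levelIn A? (suc i)) + coefficient (suc k) (suc k) * levelIn A? (2 + k)
        ≡⟨ cong₂ _+_ (∑-upTo-cong (suc k) step) (cong (_* levelIn A? (2 + k)) (coefficient-new k)) ⟩
      ∑ (upTo (suc k)) (λ i → out (suc k) * (coefficient k i * levelIn A? (suc i))) + chainsBelow (suc k) * levelIn A? (2 + k)
        ≡⟨ cong (_+ chainsBelow (suc k) * levelIn A? (2 + k)) (∑-*ˡ (upTo (suc k)) (out (suc k)) _) ⟩
      out (suc k) * ∑ (upTo (suc k)) (λ i → coefficient k i * levelIn A? (suc i)) + chainsBelow (suc k) * levelIn A? (2 + k)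
        ≡⟨ cong (λ t → out (suc k) * t + chainsBelow (suc k) * levelIn A? (2 + k)) (sym (total-levels k)) ⟩
      out (suc k) * total k + chainsBelow (suc k) * levelIn A? (2 + k)
        ≡⟨ sym (total-suc k) ⟩
      total (suc k) ∎)
      where
      open ≡-Reasoning
      step : ∀ i → i < suc k → coefficient (suc k) i * levelIn A? (suc i) ≡ out (suc k) * (coefficient k i * levelIn A? (suc i))
      step i (s≤s i≤k) = trans (cong (_* levelIn A? (suc i)) (coefficient-old i≤k)) (*-assoc (out (suc k)) _ _)

    -- The chains meeting the antichain weigh at most as much as all chains. Divided by that total
    -- weight and read with `coefficient-level`, this is the usual bound of 1 on the sum of the
    -- occupied fractions of the levels.
    lym : ∀ k → ∑ (upTo (suc k)) (λ i → coefficient k i * levelIn A? (suc i)) ≤ chainsBelow k * level (suc k)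
    lym k = subst (_≤ chainsBelow k * level (suc k)) (total-levels k) (total≤ k)

-- The flow on R_{n,l}

Between : ∀ {n} → Fin n → Fin n → Fin n → Set
Between a b c = (a Fin.≤ b × b Fin.≤ c) ⊎ (c Fin.≤ b × b Fin.≤ a)

between? : ∀ {n} (a b c : Fin n) → Dec (Between a b c)
between? a b c = (a Fin.≤? b ×-dec b Fin.≤? c) ⊎-dec (c Fin.≤? b ×-dec b Fin.≤? a)

between-collapse : ∀ {n} {a b : Fin n} → Between a b a → b ≡ a
between-collapse (inj₁ (p , q)) = Fin.≤-antisym q p
between-collapse (inj₂ (p , q)) = Fin.≤-antisym q p

between-start : ∀ {n} (a b : Fin n) → Between a a b
between-start a b with Fin.≤-total a b
... | inj₁ p = inj₁ (≤-refl , p)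
... | inj₂ q = inj₂ (q , ≤-refl)

between-sym : ∀ {n} {a b c : Fin n} → Between a b c → Between c b a
between-sym (inj₁ p) = inj₂ p
between-sym (inj₂ p) = inj₁ p

between-trans : ∀ {n} {a b c d : Fin n} → Between a b c → Between a c d → Between a b d
between-trans {b = b} (inj₁ (ab , bc)) (inj₁ (ac , cd)) = inj₁ (ab , ≤-trans bc cd)
-- Opposite orientations close a cycle `a ≤ b ≤ c ≤ a`, which forces `a` and `b` to coincide.
between-trans {a = a} {b} (inj₁ (ab , bc)) (inj₂ (dc , ca)) with Fin.≤-antisym ab (≤-trans bc ca)
... | refl = between-start a _
between-trans {a = a} {b} (inj₂ (cb , ba)) (inj₁ (ac , cd)) with Fin.≤-antisym ba (≤-trans ac cb)
... | refl = between-start a _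
between-trans (inj₂ (cb , ba)) (inj₂ (dc , ca)) = inj₂ (≤-trans dc cb , ba)

-- Two points on the way from `a` to `d` are comparable: one of them is passed first.
between-total : ∀ {n} {a b c d : Fin n} → Between a b d → Between a c d → Between a b c ⊎ Between a c b
between-total {b = b} {c} (inj₁ (ab , bd)) (inj₁ (ac , cd)) with Fin.≤-total b c
... | inj₁ bc = inj₁ (inj₁ (ab , bc))
... | inj₂ cb = inj₂ (inj₁ (ac , cb))
between-total {b = b} {c} (inj₂ (db , ba)) (inj₂ (dc , ca)) with Fin.≤-total b c
... | inj₁ bc = inj₂ (inj₂ (bc , ca))
... | inj₂ cb = inj₁ (inj₂ (cb , ba))
between-total (inj₁ (ab , bd)) (inj₂ (dc , ca)) = inj₁ (inj₁ (ab , ≤-trans bd dc))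
between-total (inj₂ (db , ba)) (inj₁ (ac , cd)) = inj₁ (inj₂ (≤-trans cd db , ba))

-- The distance from `a` strictly grows along the way from `a` to `t`, so a point on it that is as
-- far away as `t` is `t`.
∣-∣-cancel-between : ∀ {n} {a t u : Fin n} → Between a u t → ∣ toℕ t - toℕ a ∣ ≤ ∣ toℕ u - toℕ a ∣ → u ≡ t
∣-∣-cancel-between {a = a} {t} {u} (inj₁ (au , ut)) le = Fin.≤-antisym ut (begin
  toℕ t ≡⟨ sym (m∸n+n≡m (≤-trans au ut)) ⟩
  toℕ t ∸ toℕ a + toℕ a ≡⟨ cong (_+ toℕ a) (sym (m≤n⇒∣n-m∣≡n∸m (≤-trans au ut))) ⟩
  ∣ toℕ t - toℕ a ∣ + toℕ a ≤⟨ +-monoˡ-≤ (toℕ a) le ⟩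
  ∣ toℕ u - toℕ a ∣ + toℕ a ≡⟨ cong (_+ toℕ a) (m≤n⇒∣n-m∣≡n∸m au) ⟩
  toℕ u ∸ toℕ a + toℕ a ≡⟨ m∸n+n≡m au ⟩
  toℕ u ∎)
  where open ≤-Reasoning
∣-∣-cancel-between {a = a} {t} {u} (inj₂ (tu , ua)) le = Fin.≤-antisym
  (∸-cancelʳ-≤ ua (subst (_≤ toℕ a ∸ toℕ u) (m≤n⇒∣m-n∣≡n∸m (≤-trans tu ua)) (subst (∣ toℕ t - toℕ a ∣ ≤_) (m≤n⇒∣m-n∣≡n∸m ua) le)))
  tu

-- Minimise the distance from `a` over the points of `P` on the way to `b`, with `b` as first
-- candidate. A point of `P` between `a` and the minimiser is again on the way to `b`, so it
-- competes too.
nearest : ∀ {n} {P : Fin n → Set} (P? : Decidable P) a {b} → P b →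
  ∃ λ t → P t × Between a t b × (∀ u → P u → Between a u t → u ≡ t)
nearest P? a {b} pb
  with minimiser (λ t → P? t ×-dec between? a t b) (λ t → ∣ toℕ t - toℕ a ∣) (b , pb , between-sym (between-start b a))
... | t , (pt , atb) , min = t , pt , atb ,
  λ u pu aut → ∣-∣-cancel-between aut (min u (pu , between-trans aut atb))

-- Cardinalities, unions and single changes of a tuple

∣∣≡∑ : ∀ {n} (p : Subset n) → ∣ p ∣ ≡ ∑ (allFin n) (λ u → ⟦ u ∈? p ⟧)
∣∣≡∑ [] = refl
∣∣≡∑ {suc n} (b ∷ p) = trans (head b) (sym (∑-allFin-suc n (λ u → ⟦ u ∈? (b ∷ p) ⟧)))
  where
  tail : ∣ p ∣ ≡ ∑ (allFin n) (λ u → ⟦ Fin.suc u ∈? (b ∷ p) ⟧)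
  tail = trans (∣∣≡∑ p) (∑-cong (allFin n) (λ u → ⟦⟧-cong (u ∈? p) (Fin.suc u ∈? (b ∷ p)) there drop-there))
  head : ∀ c → ∣ c ∷ p ∣ ≡ ⟦ Fin.zero ∈? (c ∷ p) ⟧ + ∑ (allFin n) (λ u → ⟦ Fin.suc u ∈? (b ∷ p) ⟧)
  head true = cong suc tail
  head false = tail

∑-one : ∀ n → ∑ (allFin n) (λ _ → 1) ≡ n
∑-one zero = refl
∑-one (suc n) = trans (∑-allFin-suc n (λ _ → 1)) (cong suc (∑-one n))

∈-⋃⁻ : ∀ {n k} (As : Vec (Subset n) k) {u} → u ∈ ⋃ (Vec.toList As) → ∃ λ i → u ∈ lookup As i
∈-⋃⁻ [] u∈ = contradiction u∈ ∉⊥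
∈-⋃⁻ (A ∷ As) u∈ with x∈p∪q⁻ A _ u∈
... | inj₁ u∈A = Fin.zero , u∈A
... | inj₂ u∈As with ∈-⋃⁻ As u∈As
... | i , u∈Aᵢ = Fin.suc i , u∈Aᵢ

∈-⋃⁺ : ∀ {n k} (As : Vec (Subset n) k) {u} → ∃ (λ i → u ∈ lookup As i) → u ∈ ⋃ (Vec.toList As)
∈-⋃⁺ (A ∷ As) (Fin.zero , u∈) = x∈p∪q⁺ (inj₁ u∈)
∈-⋃⁺ (A ∷ As) (Fin.suc i , u∈) = x∈p∪q⁺ {p = A} (inj₂ (∈-⋃⁺ As (i , u∈)))

-- The tuple is treated as a Boolean matrix. Since `adjoin` and `detach` overwrite the same kind of
-- entry, `assign-assign` and `assign-id` show that they undo each other.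
assign : ∀ {n k} → Vec (Subset n) k → Fin k → Fin n → Bool → Vec (Subset n) k
assign As j e b = As [ j ]≔ (lookup As j [ e ]≔ b)

assign-assign : ∀ {n k} (As : Vec (Subset n) k) j e b c → assign (assign As j e b) j e c ≡ assign As j e c
assign-assign As j e b c = trans
  ([]≔-idempotent As j)
  (cong (As [ j ]≔_) (trans (cong (_[ e ]≔ c) (lookup∘update j As _)) ([]≔-idempotent (lookup As j) e)))

assign-id : ∀ {n k} (As : Vec (Subset n) k) j e {b} → lookup (lookup As j) e ≡ b → assign As j e b ≡ As
assign-id As j e refl = trans (cong (As [ j ]≔_) ([]≔-lookup (lookup As j) e)) ([]≔-lookup As j)

assign-hit : ∀ {n k} (As : Vec (Subset n) k) j e b → lookup (lookup (assign As j e b) j) e ≡ b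
assign-hit As j e b = trans (cong (λ A → lookup A e) (lookup∘update j As _)) (lookup∘update e (lookup As j) b)

assign-miss : ∀ {n k} (As : Vec (Subset n) k) j e b i u → ¬ (i ≡ j × u ≡ e) →
  lookup (lookup (assign As j e b) i) u ≡ lookup (lookup As i) u
assign-miss As j e b i u miss with i Fin.≟ j | u Fin.≟ e
... | no i≢j | _ = cong (λ A → lookup A u) (lookup∘update′ i≢j As _)
... | yes refl | yes refl = contradiction (refl , refl) miss
... | yes refl | no u≢e = trans (cong (λ A → lookup A u) (lookup∘update i As _)) (lookup∘update′ u≢e (lookup As i) b)

lookup-injective : ∀ {n k} {As Bs : Vec (Subset n) k} → (∀ i → lookup As i ≡ lookup Bs i) → As ≡ Bs
lookup-injective {As = As} {Bs} eq = trans (sym (tabulate∘lookup As)) (trans (tabulate-cong eq) (tabulate∘lookup Bs))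

adjoin detach : ∀ {n k} → Vec (Subset n) k → Fin k → Fin n → Vec (Subset n) k
adjoin As j e = assign As j e true
detach As j e = assign As j e false

∉⇒lookup : ∀ {n} {p : Subset n} {u} → u ∉ p → lookup p u ≡ false
∉⇒lookup u∉p = Bool.¬-not (u∉p ∘ lookup⇒[]= _ _)

module _ {n k} (As : Vec (Subset n) k) {j : Fin k} {e : Fin n} where

  ∈-miss : ∀ {b i u} → ¬ (i ≡ j × u ≡ e) → u ∈ lookup As i → u ∈ lookup (assign As j e b) i
  ∈-miss {b} {i} {u} miss u∈ = lookup⇒[]= _ _ (trans (assign-miss As j e b i u miss) ([]=⇒lookup u∈))

  ∈-miss⁻ : ∀ {b i u} → ¬ (i ≡ j × u ≡ e) → u ∈ lookup (assign As j e b) i → u ∈ lookup As i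
  ∈-miss⁻ {b} {i} {u} miss u∈ = lookup⇒[]= _ _ (trans (sym (assign-miss As j e b i u miss)) ([]=⇒lookup u∈))

  ∈-adjoin-new : e ∈ lookup (adjoin As j e) j
  ∈-adjoin-new = lookup⇒[]= _ _ (assign-hit As j e true)

  ∈-adjoin⁻ : ∀ {i u} → u ∈ lookup (adjoin As j e) i → u ∈ lookup As i ⊎ (i ≡ j × u ≡ e)
  ∈-adjoin⁻ {i} {u} u∈ with i Fin.≟ j ×-dec u Fin.≟ e
  ... | yes hit = inj₂ hit
  ... | no miss = inj₁ (∈-miss⁻ miss u∈)

  ∈-adjoin⁺ : ∀ {i u} → u ∈ lookup As i → u ∈ lookup (adjoin As j e) i
  ∈-adjoin⁺ {i} {u} u∈ with i Fin.≟ j ×-dec u Fin.≟ e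
  ... | yes (refl , refl) = ∈-adjoin-new
  ... | no miss = ∈-miss miss u∈

  ∉-detach : e ∉ lookup (detach As j e) j
  ∉-detach e∈ with trans (sym (assign-hit As j e false)) ([]=⇒lookup e∈)
  ... | ()

  ∈-detach⁻ : ∀ {i u} → u ∈ lookup (detach As j e) i → u ∈ lookup As i
  ∈-detach⁻ {i} {u} u∈ with i Fin.≟ j ×-dec u Fin.≟ e
  ... | yes (refl , refl) = contradiction u∈ ∉-detach
  ... | no miss = ∈-miss⁻ miss u∈

-- Order and convexity of the parts, and the arcs

valid-tail : ∀ {n l A} {As : Vec (Subset n) (suc l)} → Valid n (suc l) (A ∷ As) → Valid n l As
valid-tail (nonempty , ordered) = nonempty ∘ Fin.suc , ordered ∘ Fin.suc

-- `Valid` compares adjacent parts only; an element of the next part, which is nonempty, links to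
-- the later ones.
parts-ordered : ∀ {n l} (As : Vec (Subset n) (suc l)) → Valid n l As → ∀ i j {a b} → i Fin.< j →
  a ∈ lookup As i → b ∈ lookup As j → a Fin.< b
parts-ordered (A ∷ B ∷ As) (_ , ordered) Fin.zero (Fin.suc Fin.zero) _ a∈ b∈ = ordered Fin.zero _ _ a∈ b∈
parts-ordered (A ∷ B ∷ As) v@(nonempty , ordered) Fin.zero (Fin.suc (Fin.suc j)) _ a∈ b∈
  with nonempty (Fin.suc Fin.zero)
... | c , c∈ = <-trans (ordered Fin.zero _ _ a∈ c∈)
                 (parts-ordered (B ∷ As) (valid-tail v) Fin.zero (Fin.suc j) (s≤s z≤n) c∈ b∈)
parts-ordered (A ∷ B ∷ As) v (Fin.suc i) (Fin.suc j) (s≤s i<j) a∈ b∈ =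
  parts-ordered (B ∷ As) (valid-tail v) i j i<j a∈ b∈

module _ {n l : ℕ} where

  -- The stored proof is irrelevant; decidability of validity recovers one that can be taken apart.
  isValid : (x : R n l) → Valid n l (tuple x)
  isValid (mkR As v) = recompute (valid? n l As) v

  part : R n l → Fin (suc l) → Subset n
  part x i = lookup (tuple x) i

  infix 4 _∈ᵘ_ _∈ᵘ?_

  _∈ᵘ_ : Fin n → R n l → Set
  u ∈ᵘ x = ∃ λ i → u ∈ part x i

  _∈ᵘ?_ : ∀ u x → Dec (u ∈ᵘ x)
  u ∈ᵘ? x = any? (λ i → u ∈? part x i)

  size : R n l → ℕ
  size x = ∑ (allFin n) (λ u → ⟦ u ∈ᵘ? x ⟧)

  ∣⋃∣≡size : ∀ x → ∣ ⋃ (Vec.toList (tuple x)) ∣ ≡ size x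
  ∣⋃∣≡size x = trans (∣∣≡∑ (⋃ (Vec.toList (tuple x)))) (∑-cong (allFin n) (λ u →
    ⟦⟧-cong (u ∈? ⋃ (Vec.toList (tuple x))) (u ∈ᵘ? x) (∈-⋃⁻ (tuple x)) (∈-⋃⁺ (tuple x))))

  part-unique : ∀ x {i j a} → a ∈ part x i → a ∈ part x j → i ≡ j
  part-unique x {i} {j} a∈i a∈j with Fin.<-cmp i j
  ... | tri< i<j _ _ = contradiction (parts-ordered (tuple x) (isValid x) i j i<j a∈i a∈j) (n≮n _)
  ... | tri≈ _ i≡j _ = i≡j
  ... | tri> _ _ j<i = contradiction (parts-ordered (tuple x) (isValid x) j i j<i a∈j a∈i) (n≮n _)

  -- Every other part lies entirely to the left or entirely to the right of part `i`, so it has no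
  -- element between two elements of part `i`.
  part-convex : ∀ x {i j a b c} → a ∈ part x i → c ∈ part x i → b ∈ part x j → Between a b c → j ≡ i
  part-convex x {i} {j} a∈ c∈ b∈ btw with Fin.<-cmp i j | btw
  ... | tri≈ _ i≡j _ | _ = sym i≡j
  ... | tri< i<j _ _ | inj₁ (_ , bc) = contradiction bc (<⇒≱ (parts-ordered (tuple x) (isValid x) i j i<j c∈ b∈))
  ... | tri< i<j _ _ | inj₂ (_ , ba) = contradiction ba (<⇒≱ (parts-ordered (tuple x) (isValid x) i j i<j a∈ b∈))
  ... | tri> _ _ j<i | inj₁ (ab , _) = contradiction ab (<⇒≱ (parts-ordered (tuple x) (isValid x) j i j<i b∈ a∈))
  ... | tri> _ _ j<i | inj₂ (cb , _) = contradiction cb (<⇒≱ (parts-ordered (tuple x) (isValid x) j i j<i b∈ c∈))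

  -- Some t of part j between e and s is enough: as y is valid and its parts are convex, j is then the
  -- part of the first element of x on the way from e to s.
  Arc : Fin n → Fin n → R n l → R n l → Set
  Arc e s x y = ¬ (e ∈ᵘ x) × s ∈ᵘ x ×
    ∃ λ j → tuple y ≡ adjoin (tuple x) j e × ∃ λ t → t ∈ part x j × Between e t s

  arc? : ∀ e s x y → Dec (Arc e s x y)
  arc? e s x y = ¬? (e ∈ᵘ? x) ×-dec s ∈ᵘ? x ×-dec
    any? (λ j → ≡-dec (≡-dec Bool._≟_) (tuple y) (adjoin (tuple x) j e) ×-dec
      any? (λ t → t ∈? part x j ×-dec between? e t s))

  -- What `y` must satisfy for an arc with data `e` and `s` to end in it: after removal of `e`, the
  -- same `t` keeps the part nonempty and witnesses the arc.
  Movable : Fin n → Fin n → R n l → Set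
  Movable e s y = s ∈ᵘ y × ∃ λ j → e ∈ part y j × ∃ λ t → t ∈ part y j × t ≢ e × Between e t s

  movable? : ∀ e s y → Dec (Movable e s y)
  movable? e s y = s ∈ᵘ? y ×-dec any? (λ j → e ∈? part y j ×-dec
    any? (λ t → t ∈? part y j ×-dec ¬? (t Fin.≟ e) ×-dec between? e t s))

  -- No element of `x` other than `t` lies between `e` and `t`, so `e` compares with the other parts
  -- exactly as `t` does.
  adjoin-valid : ∀ x {j e t} → t ∈ part x j → (∀ u → u ∈ᵘ x → Between e u t → u ≡ t) →
    Valid n l (adjoin (tuple x) j e)
  adjoin-valid x {j} {e} {t} t∈ near = nonempty , ordered
    where
    nonempty : ∀ i → ∃ λ u → u ∈ lookup (adjoin (tuple x) j e) i
    nonempty i with proj₁ (isValid x) i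
    ... | u , u∈ = u , ∈-adjoin⁺ (tuple x) u∈
    before : ∀ {a} → a ∈ᵘ x → a Fin.< t → a Fin.< e
    before {a} a∈ a<t = ≰⇒> (λ e≤a → contradiction (near a a∈ (inj₁ (e≤a , <⇒≤ a<t))) (Fin.<⇒≢ a<t))
    after : ∀ {a} → a ∈ᵘ x → t Fin.< a → e Fin.< a
    after {a} a∈ t<a = ≰⇒> (λ a≤e → contradiction (sym (near a a∈ (inj₂ (<⇒≤ t<a , a≤e)))) (Fin.<⇒≢ t<a))
    ordered : ∀ i → MaxBelowMin (lookup (adjoin (tuple x) j e) (inject₁ i)) (lookup (adjoin (tuple x) j e) (Fin.suc i))
    ordered i a b a∈ b∈ with ∈-adjoin⁻ (tuple x) {i = inject₁ i} a∈ | ∈-adjoin⁻ (tuple x) {i = Fin.suc i} b∈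
    ... | inj₁ a∈x | inj₁ b∈x = proj₂ (isValid x) i a b a∈x b∈x
    ... | inj₁ a∈x | inj₂ (refl , refl) = before (_ , a∈x) (proj₂ (isValid x) i a t a∈x t∈)
    ... | inj₂ (refl , refl) | inj₁ b∈x = after (_ , b∈x) (proj₂ (isValid x) i t b t∈ b∈x)
    ... | inj₂ (refl , _) | inj₂ (i≡ , _) = contradiction (trans (cong toℕ i≡) (toℕ-inject₁ i)) 1+n≢n

  -- The new element joins the part of the nearest `t`. Any other witness `t′` either comes no later
  -- than `t`, hence equals it, or has `t` between `e` and itself; then convexity in `y′` puts `t`
  -- in the same part.
  arc-up : ∀ x e s → ¬ (e ∈ᵘ x) → s ∈ᵘ x → ∃ λ y → Arc e s x y × (∀ y′ → Arc e s x y′ → y′ ≡ y)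
  arc-up x e s e∉ s∈ with nearest (_∈ᵘ? x) e s∈
  ... | t , (j , t∈) , ets , near = y , (e∉ , s∈ , j , refl , t , t∈ , ets) , unique
    where
    y : R n l
    y = mkR (adjoin (tuple x) j e) (adjoin-valid x t∈ near)
    unique : ∀ y′ → Arc e s x y′ → y′ ≡ y
    unique y′@(mkR _ _) (_ , _ , j′ , refl , t′ , t′∈ , et′s) with between-total ets et′s
    ... | inj₂ et′t with near t′ (j′ , t′∈) et′t
    ...   | refl with part-unique x t∈ t′∈
    ...     | refl = refl
    unique y′@(mkR _ _) (_ , _ , j′ , refl , t′ , t′∈ , et′s) | inj₁ ett′
      with part-convex y′ (∈-adjoin-new (tuple x)) (∈-adjoin⁺ (tuple x) t′∈) (∈-adjoin⁺ (tuple x) t∈) ett′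
    ... | refl = refl

  arc⇒movable : ∀ {e s x y} → Arc e s x y → Movable e s y
  arc⇒movable {e} {s} {x} {mkR _ _} (e∉ , (k , s∈) , j , refl , t , t∈ , ets) =
    (k , ∈-adjoin⁺ (tuple x) s∈) , j , ∈-adjoin-new (tuple x) ,
    t , ∈-adjoin⁺ (tuple x) t∈ , (λ { refl → e∉ (j , t∈) }) , ets

  -- The source can only be `y` without `e`. Its part stays nonempty because of `t`, and `s`
  -- survives since `s ≡ e` would force `t ≡ e`.
  arc-down : ∀ y e s → Movable e s y → ∃ λ x → Arc e s x y × (∀ x′ → Arc e s x′ y → x′ ≡ x)
  arc-down y e s ((k , s∈) , j , e∈ , t , t∈ , t≢e , ets) =
    x , (e∉ , (k , kept s≢e s∈) , j , sym restored , t , kept t≢e t∈ , ets) , unique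
    where
    s≢e : s ≢ e
    s≢e refl = t≢e (between-collapse ets)
    kept : ∀ {u i} → u ≢ e → u ∈ part y i → u ∈ lookup (detach (tuple y) j e) i
    kept u≢e = ∈-miss (tuple y) (u≢e ∘ proj₂)
    nonempty : ∀ i → ∃ λ u → u ∈ lookup (detach (tuple y) j e) i
    nonempty i with i Fin.≟ j
    ... | yes refl = t , kept t≢e t∈
    ... | no i≢j with proj₁ (isValid y) i
    ...   | u , u∈ = u , ∈-miss (tuple y) (i≢j ∘ proj₁) u∈
    x : R n l
    x = mkR (detach (tuple y) j e) (nonempty , λ i a b a∈ b∈ →
      proj₂ (isValid y) i a b (∈-detach⁻ (tuple y) a∈) (∈-detach⁻ (tuple y) b∈))
    e∉ : ¬ (e ∈ᵘ x)
    e∉ (i , e∈i) with part-unique y e∈ (∈-detach⁻ (tuple y) {i = i} e∈i)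
    ... | refl = ∉-detach (tuple y) e∈i
    restored : adjoin (detach (tuple y) j e) j e ≡ tuple y
    restored = trans (assign-assign (tuple y) j e false true) (assign-id (tuple y) j e ([]=⇒lookup e∈))
    -- Disjointness of the parts of `y` fixes the part that `e` joined; as `e` is not in `x′`,
    -- detaching it there restores `x′`.
    unique : ∀ x′ → Arc e s x′ y → x′ ≡ x
    unique x′ (e∉′ , _ , j′ , eq , _)
      with part-unique y e∈ (subst (λ As → e ∈ lookup As j′) (sym eq) (∈-adjoin-new (tuple x′)))
    ... | refl = tuple-injective (sym (trans (cong (λ As → detach As j e) eq)
      (trans (assign-assign (tuple x′) j e true false) (assign-id (tuple x′) j e (∉⇒lookup (λ e∈j → e∉′ (j , e∈j)))))))

  arc⇒≤ : ∀ {e s x y} → Arc e s x y → x ≤R y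
  arc⇒≤ {x = x} (_ , _ , j , eq , _) i {u} u∈ = subst (λ As → u ∈ lookup As i) (sym eq) (∈-adjoin⁺ (tuple x) u∈)

  arc⇒≢ : ∀ {e s x y} → Arc e s x y → tuple x ≢ tuple y
  arc⇒≢ {e} {x = x} (e∉ , _ , j , eq , _) x≡y =
    e∉ (j , subst (λ As → e ∈ lookup As j) (sym (trans x≡y eq)) (∈-adjoin-new (tuple x)))

  ≤R-antisym-tuple : ∀ {x y : R n l} → x ≤R y → y ≤R x → tuple x ≡ tuple y
  ≤R-antisym-tuple x≤y y≤x = lookup-injective (λ i → ⊆-antisym (x≤y i) (y≤x i))

  -- The two tuples differ in a single membership, and an intermediate `z` equals one or the other
  -- according to whether it has that membership.
  arc⇒⋖ : ∀ {e s x y} → Arc e s x y → x ⋖ y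
  arc⇒⋖ {e} {s} {x} {y@(mkR _ _)} arc@(_ , _ , j , refl , _) = (arc⇒≤ {x = x} {y} arc , arc⇒≢ {x = x} {y} arc) , between
    where
    between : ∀ z → ¬ (x <R z × z <R y)
    between z ((x≤z , x≢z) , (z≤y , z≢y)) with e ∈? part z j
    ... | yes e∈ = z≢y (≤R-antisym-tuple {z} {y} z≤y y≤z)
      where
      y≤z : y ≤R z
      y≤z i u∈ with ∈-adjoin⁻ (tuple x) {i = i} u∈
      ... | inj₁ u∈x = x≤z i u∈x
      ... | inj₂ (refl , refl) = e∈
    ... | no e∉ = x≢z (≤R-antisym-tuple {x} {z} x≤z z≤x)
      where
      z≤x : z ≤R x
      z≤x i u∈ with ∈-adjoin⁻ (tuple x) {i = i} (z≤y i u∈)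
      ... | inj₁ u∈x = u∈x
      ... | inj₂ (refl , refl) = contradiction u∈ e∉

  arc-size : ∀ {e s x y} → Arc e s x y → size y ≡ suc (size x)
  arc-size {e} {s} {x} {y@(mkR _ _)} (e∉ , _ , j , refl , _) = begin
    size y
      ≡⟨ ∑-cong (allFin n) pointwise ⟩
    ∑ (allFin n) (λ u → ⟦ u Fin.≟ e ⟧ + ⟦ u ∈ᵘ? x ⟧)
      ≡⟨ ∑-+ (allFin n) _ _ ⟩
    ∑ (allFin n) (λ u → ⟦ u Fin.≟ e ⟧) + size x
      ≡⟨ cong (_+ size x) (∑-unique (Fin._≟ e) (allFin n) (allFin-once e) refl (λ _ → id)) ⟩
    suc (size x) ∎
    where
    open ≡-Reasoning
    pointwise : ∀ u → ⟦ u ∈ᵘ? y ⟧ ≡ ⟦ u Fin.≟ e ⟧ + ⟦ u ∈ᵘ? x ⟧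
    pointwise u with u Fin.≟ e
    ... | yes refl = trans (⟦⟧-yes (e ∈ᵘ? y) (j , ∈-adjoin-new (tuple x))) (cong suc (sym (⟦⟧-no (e ∈ᵘ? x) e∉)))
    ... | no u≢e = ⟦⟧-cong (u ∈ᵘ? y) (u ∈ᵘ? x) old (λ { (i , u∈) → i , ∈-adjoin⁺ (tuple x) u∈ })
      where
      old : u ∈ᵘ y → u ∈ᵘ x
      old (i , u∈) with ∈-adjoin⁻ (tuple x) {i = i} u∈
      ... | inj₁ u∈x = i , u∈x
      ... | inj₂ (_ , u≡e) = contradiction u≡e u≢e

  -- Counting the movable elements

  Nearest : Fin (suc l) → Fin n → Fin n → R n l → Set
  Nearest j e s y = e ∈ part y j × ∀ t → t ∈ part y j → Between e t s → t ≡ e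

  nearest? : ∀ j e s y → Dec (Nearest j e s y)
  nearest? j e s y = e ∈? part y j ×-dec all? (λ t → (t ∈? part y j) →-dec (between? e t s →-dec (t Fin.≟ e)))

  -- Two nearest elements on the same side of `s` are comparable. If they lie on different sides,
  -- convexity puts `s` itself in part `j`, and `s` is then the nearest element.
  nearest-exists-unique : ∀ y s j → s ∈ᵘ y →
    ∃ λ e → Nearest j e s y × (∀ e′ → Nearest j e′ s y → e′ ≡ e)
  nearest-exists-unique y s j (k , s∈) with proj₁ (isValid y) j
  ... | b , b∈ with nearest (_∈? part y j) s b∈
  ... | e , e∈ , _ , near = e , (e∈ , λ t t∈ ets → near t t∈ (between-sym ets)) , unique
    where
    straddle : ∀ e′ → Nearest j e′ s y → k ≡ j → e′ ≡ e
    straddle e′ (_ , near′) refl = trans (sym (near′ s s∈ (between-sym (between-start s e′)))) (near s s∈ (between-start s e))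
    unique : ∀ e′ → Nearest j e′ s y → e′ ≡ e
    unique e′ (e′∈ , near′) with Fin.≤-total e s | Fin.≤-total e′ s | Fin.≤-total e e′
    ... | inj₁ es | inj₁ e′s | inj₁ ee′ = near e′ e′∈ (inj₂ (ee′ , e′s))
    ... | inj₁ es | inj₁ e′s | inj₂ e′e = sym (near′ e e∈ (inj₁ (e′e , es)))
    ... | inj₂ se | inj₂ se′ | inj₁ ee′ = sym (near′ e e∈ (inj₂ (se , ee′)))
    ... | inj₂ se | inj₂ se′ | inj₂ e′e = near e′ e′∈ (inj₁ (se′ , e′e))
    ... | inj₁ es | inj₂ se′ | _ = straddle e′ (e′∈ , near′) (part-convex y e∈ e′∈ s∈ (inj₁ (es , se′)))
    ... | inj₂ se | inj₁ e′s | _ = straddle e′ (e′∈ , near′) (part-convex y e∈ e′∈ s∈ (inj₂ (e′s , se)))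

  -- An element that is not movable is the nearest of its part; since the parts are disjoint, the
  -- sum over `j` counts it once.
  movable-or-nearest : ∀ y s e → s ∈ᵘ y →
    ⟦ e ∈ᵘ? y ⟧ ≡ ⟦ movable? e s y ⟧ + ∑ (allFin (suc l)) (λ j → ⟦ nearest? j e s y ⟧)
  movable-or-nearest y s e s∈ with e ∈ᵘ? y
  ... | no e∉ = sym (cong₂ _+_ (⟦⟧-no (movable? e s y) (λ { (_ , j , e∈ , _) → e∉ (j , e∈) }))
                  (∑-none (λ j → nearest? j e s y) (allFin (suc l)) (λ { j (e∈ , _) → e∉ (j , e∈) })))
  ... | yes (j , e∈) with movable? e s y
  ...   | yes (_ , j′ , e∈′ , t , t∈ , t≢e , ets) = cong suc (sym (∑-none (λ i → nearest? i e s y) (allFin (suc l)) none))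
    where
    none : ∀ i → ¬ Nearest i e s y
    none i (e∈i , near) with part-unique y e∈i e∈′
    ... | refl = t≢e (near t t∈ ets)
  ...   | no immovable = sym (∑-unique (λ i → nearest? i e s y) (allFin (suc l)) (allFin-once j) (e∈ , near) (λ { i (e∈i , _) → part-unique y e∈i e∈ }))
    where
    near : ∀ t → t ∈ part y j → Between e t s → t ≡ e
    near t t∈ ets with t Fin.≟ e
    ... | yes eq = eq
    ... | no t≢e = contradiction (s∈ , j , e∈ , t , t∈ , t≢e , ets) immovable

  -- Seen from s, every part has exactly one element that cannot be moved: the nearest one.
  movable-count : ∀ y s → s ∈ᵘ y → size y ≡ ∑ (allFin n) (λ e → ⟦ movable? e s y ⟧) + suc l
  movable-count y s s∈ = begin
    size y
      ≡⟨ ∑-cong (allFin n) (λ e → movable-or-nearest y s e s∈) ⟩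
    ∑ (allFin n) (λ e → ⟦ movable? e s y ⟧ + ∑ (allFin (suc l)) (λ j → ⟦ nearest? j e s y ⟧))
      ≡⟨ ∑-+ (allFin n) _ _ ⟩
    movables + ∑ (allFin n) (λ e → ∑ (allFin (suc l)) (λ j → ⟦ nearest? j e s y ⟧))
      ≡⟨ cong (movables +_) (∑-swap (allFin n) (allFin (suc l)) _) ⟩
    movables + ∑ (allFin (suc l)) (λ j → ∑ (allFin n) (λ e → ⟦ nearest? j e s y ⟧))
      ≡⟨ cong (movables +_) (∑-cong (allFin (suc l)) one) ⟩
    movables + ∑ (allFin (suc l)) (λ _ → 1)
      ≡⟨ cong (movables +_) (∑-one (suc l)) ⟩
    movables + suc l ∎
    where
    open ≡-Reasoning
    movables : ℕ
    movables = ∑ (allFin n) (λ e → ⟦ movable? e s y ⟧)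
    one : ∀ j → ∑ (allFin n) (λ e → ⟦ nearest? j e s y ⟧) ≡ 1
    one j = let e , near , unique = nearest-exists-unique y s j s∈ in
      ∑-unique (λ e → nearest? j e s y) (allFin n) (allFin-once e) near unique

  -- `movable-count` exhibits one immovable element for each of the `suc l` parts. This makes the
  -- truncated subtraction in `rank` exact.
  size>l : ∀ (x : R n l) → suc l ≤ size x
  size>l x with proj₁ (isValid x) Fin.zero
  ... | s , s∈ = subst (suc l ≤_) (sym (movable-count x s (Fin.zero , s∈))) (m≤n+m (suc l) _)

  size≤n : ∀ x → size x ≤ n
  size≤n x = subst (size x ≤_) (∑-one n) (∑-mono (allFin n) (λ u → ⟦⟧≤1 (u ∈ᵘ? x)))

  rank+l≡size : ∀ x → rank x + l ≡ size x
  rank+l≡size x = trans (cong (λ s → s ∸ l + l) (∣⋃∣≡size x)) (m∸n+n≡m (<⇒≤ (size>l x)))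

  rank≥1 : ∀ x → 1 ≤ rank x
  rank≥1 x = +-cancelʳ-≤ l 1 (rank x) (subst (suc l ≤_) (sym (rank+l≡size x)) (size>l x))

  rank≤n∸l : ∀ x → rank x ≤ n ∸ l
  rank≤n∸l x = subst (λ s → s ∸ l ≤ n ∸ l) (sym (∣⋃∣≡size x)) (∸-monoˡ-≤ l (size≤n x))

  -- The total flow out of and into an element

  flow : R n l → R n l → ℕ
  flow x y = ∑ (allFin n) (λ e → ∑ (allFin n) (λ s → ⟦ arc? e s x y ⟧))

  flow-support : ∀ x y → flow x y ≡ 0 ⊎ (∃ λ e → ∃ λ s → Arc e s x y)
  flow-support x y with any? (λ e → any? (λ s → arc? e s x y))
  ... | yes found = inj₂ found
  ... | no none = inj₁ (∑-zero (allFin n) (λ e → ∑-none (λ s → arc? e s x y) (allFin n) (λ s arc → none (e , s , arc))))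

  ∑∑-swap : ∀ (h : R n l → Fin n → Fin n → ℕ) →
    ∑ (elems n l) (λ x → ∑ (allFin n) (λ e → ∑ (allFin n) (h x e))) ≡
    ∑ (allFin n) (λ e → ∑ (allFin n) (λ s → ∑ (elems n l) (λ x → h x e s)))
  ∑∑-swap h = trans (∑-swap (elems n l) (allFin n) _) (∑-cong (allFin n) (λ e → ∑-swap (elems n l) (allFin n) (λ x → h x e)))

  size-complement : ∀ x → ∑ (allFin n) (λ e → ⟦ ¬? (e ∈ᵘ? x) ⟧) ≡ n ∸ size x
  size-complement x = begin
    outside ≡⟨ sym (m+n∸n≡m outside (size x)) ⟩
    outside + size x ∸ size x ≡⟨ cong (_∸ size x) (sym (∑-+ (allFin n) _ _)) ⟩
    ∑ (allFin n) (λ e → ⟦ ¬? (e ∈ᵘ? x) ⟧ + ⟦ e ∈ᵘ? x ⟧) ∸ size x ≡⟨ cong (_∸ size x) (trans (∑-cong (allFin n) (λ e → ⟦⟧-¬ (e ∈ᵘ? x))) (∑-one n)) ⟩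
    n ∸ size x ∎
    where
    open ≡-Reasoning
    outside : ℕ
    outside = ∑ (allFin n) (λ e → ⟦ ¬? (e ∈ᵘ? x) ⟧)

  outflow : ℕ → ℕ
  outflow r = (n ∸ (r + l)) * (r + l)

  -- At an element of rank `suc r` there are `suc r + l` choices of `s`, and each sees
  -- `(suc r + l) ∸ suc l`, that is `r`, movable elements.
  inflow : ℕ → ℕ
  inflow r = (suc r + l) * r

  -- With the sum over targets innermost, `arc-up` gives exactly one target for each `e` outside and
  -- `s` inside `x`.
  flow-out : ∀ x → ∑ (elems n l) (flow x) ≡ outflow (rank x)
  flow-out x = begin
    ∑ (elems n l) (flow x)
      ≡⟨ ∑∑-swap (λ y e s → ⟦ arc? e s x y ⟧) ⟩
    ∑ (allFin n) (λ e → ∑ (allFin n) (λ s → ∑ (elems n l) (λ y → ⟦ arc? e s x y ⟧)))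
      ≡⟨ ∑-cong (allFin n) (λ e → ∑-cong (allFin n) (λ s → pointwise e s)) ⟩
    ∑ (allFin n) (λ e → ∑ (allFin n) (λ s → ⟦ ¬? (e ∈ᵘ? x) ⟧ * ⟦ s ∈ᵘ? x ⟧))
      ≡⟨ ∑-cong (allFin n) (λ e → ∑-*ˡ (allFin n) ⟦ ¬? (e ∈ᵘ? x) ⟧ _) ⟩
    ∑ (allFin n) (λ e → ⟦ ¬? (e ∈ᵘ? x) ⟧ * size x)
      ≡⟨ ∑-*ʳ (allFin n) (size x) _ ⟩
    ∑ (allFin n) (λ e → ⟦ ¬? (e ∈ᵘ? x) ⟧) * size x
      ≡⟨ cong (_* size x) (size-complement x) ⟩
    (n ∸ size x) * size x
      ≡⟨ cong (λ m → (n ∸ m) * m) (sym (rank+l≡size x)) ⟩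
    outflow (rank x) ∎
    where
    open ≡-Reasoning
    pointwise : ∀ e s → ∑ (elems n l) (λ y → ⟦ arc? e s x y ⟧) ≡ ⟦ ¬? (e ∈ᵘ? x) ⟧ * ⟦ s ∈ᵘ? x ⟧
    pointwise e s = cases (e ∈ᵘ? x) (s ∈ᵘ? x)
      where
      cases : (e∈? : Dec (e ∈ᵘ x)) (s∈? : Dec (s ∈ᵘ x)) →
        ∑ (elems n l) (λ y → ⟦ arc? e s x y ⟧) ≡ ⟦ ¬? e∈? ⟧ * ⟦ s∈? ⟧
      cases (yes e∈) _ = ∑-none (λ y → arc? e s x y) (elems n l) (λ { _ (e∉ , _) → e∉ e∈ })
      cases (no _) (no s∉) = ∑-none (λ y → arc? e s x y) (elems n l) (λ { _ (_ , s∈ , _) → s∉ s∈ })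
      cases (no e∉) (yes s∈) = let y , arc , unique = arc-up x e s e∉ s∈ in
        ∑-unique (λ y → arc? e s x y) (elems n l) (elems-once y) arc unique

  -- Dually, `arc-down` gives one source for each movable pair, and `movable-count` counts these
  -- pairs for a fixed `s`.
  flow-in : ∀ {r} y → rank y ≡ suc r → ∑ (elems n l) (λ x → flow x y) ≡ inflow r
  flow-in {r} y rk = begin
    ∑ (elems n l) (λ x → flow x y)
      ≡⟨ ∑∑-swap (λ x e s → ⟦ arc? e s x y ⟧) ⟩
    ∑ (allFin n) (λ e → ∑ (allFin n) (λ s → ∑ (elems n l) (λ x → ⟦ arc? e s x y ⟧)))
      ≡⟨ ∑-cong (allFin n) (λ e → ∑-cong (allFin n) (λ s → pointwise e s)) ⟩
    ∑ (allFin n) (λ e → ∑ (allFin n) (λ s → ⟦ movable? e s y ⟧))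
      ≡⟨ ∑-swap (allFin n) (allFin n) _ ⟩
    ∑ (allFin n) (λ s → ∑ (allFin n) (λ e → ⟦ movable? e s y ⟧))
      ≡⟨ ∑-cong (allFin n) perTarget ⟩
    ∑ (allFin n) (λ s → ⟦ s ∈ᵘ? y ⟧ * r)
      ≡⟨ ∑-*ʳ (allFin n) r _ ⟩
    size y * r
      ≡⟨ cong (_* r) size≡ ⟩
    inflow r ∎
    where
    open ≡-Reasoning
    size≡ : size y ≡ suc r + l
    size≡ = trans (sym (rank+l≡size y)) (cong (_+ l) rk)
    pointwise : ∀ e s → ∑ (elems n l) (λ x → ⟦ arc? e s x y ⟧) ≡ ⟦ movable? e s y ⟧
    pointwise e s = cases (movable? e s y)
      where
      cases : (m? : Dec (Movable e s y)) → ∑ (elems n l) (λ x → ⟦ arc? e s x y ⟧) ≡ ⟦ m? ⟧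
      cases (no immovable) = ∑-none (λ x → arc? e s x y) (elems n l) (λ x arc → immovable (arc⇒movable {x = x} {y} arc))
      cases (yes movable) = let x , arc , unique = arc-down y e s movable in
        ∑-unique (λ x → arc? e s x y) (elems n l) (elems-once x) arc unique
    perTarget : ∀ s → ∑ (allFin n) (λ e → ⟦ movable? e s y ⟧) ≡ ⟦ s ∈ᵘ? y ⟧ * r
    perTarget s = cases (s ∈ᵘ? y)
      where
      cases : (s∈? : Dec (s ∈ᵘ y)) → ∑ (allFin n) (λ e → ⟦ movable? e s y ⟧) ≡ ⟦ s∈? ⟧ * r
      cases (no s∉) = ∑-zero (allFin n) (λ e → ⟦⟧-no (movable? e s y) (s∉ ∘ proj₁))
      cases (yes s∈) = trans
        (+-cancelʳ-≡ (suc l) _ r (trans (sym (movable-count y s s∈)) (trans size≡ (sym (+-suc r l)))))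
        (sym (+-identityʳ r))

  arc-rank : ∀ {e s x y} → Arc e s x y → rank y ≡ suc (rank x)
  arc-rank {e} {s} {x} {y} arc = +-cancelʳ-≡ l _ _
    (trans (rank+l≡size y) (trans (arc-size {x = x} {y} arc) (cong suc (sym (rank+l≡size x)))))

  uniformFlow : UniformFlow (elems n l) rank _≤R_ outflow inflow flow
  uniformFlow = record
    { support = support
    ; outflow = flow-out
    ; inflow = flow-in
    }
    where
    support : ∀ x y → flow x y ≡ 0 ⊎ (x ≤R y × x ≢ y × rank y ≡ suc (rank x))
    support x y with flow-support x y
    ... | inj₁ eq = inj₁ eq
    ... | inj₂ (e , s , arc) = inj₂ (arc⇒≤ {x = x} {y} arc , (λ { refl → arc⇒≢ {x = x} {y} arc refl }) , arc-rank {x = x} {y} arc)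

-- Normalized flow, log-concavity and the Sperner property

-- Peeling off `x` frees one unit at `x`: as `x` does not recur in `xs`, the two indicators are
-- never both 1.
∣unique∣≤∑ : ∀ {X : Set} (elements : List X) (_≟X_ : DecidableEquality X) →
  (∀ x → Once elements x) → ∀ {xs} → AllPairs _≢_ xs → length xs ≤ ∑ elements (λ x → ⟦ DecMembership._∈?_ _≟X_ x xs ⟧)
∣unique∣≤∑ _ _≟X_ once [] = z≤n
∣unique∣≤∑ elements _≟X_ once {x ∷ xs} (x∉xs ∷ unique) = begin
  suc (length xs)
    ≤⟨ s≤s (∣unique∣≤∑ elements _≟X_ once unique) ⟩
  suc (∑ elements (λ y → ⟦ y ∈ˡ? xs ⟧))
    ≡⟨ cong (_+ ∑ elements (λ y → ⟦ y ∈ˡ? xs ⟧)) (sym (∑-unique (_≟X x) elements (once x) refl (λ _ → id))) ⟩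
  ∑ elements (λ y → ⟦ y ≟X x ⟧) + ∑ elements (λ y → ⟦ y ∈ˡ? xs ⟧)
    ≡⟨ sym (∑-+ elements _ _) ⟩
  ∑ elements (λ y → ⟦ y ≟X x ⟧ + ⟦ y ∈ˡ? xs ⟧)
    ≤⟨ ∑-mono elements (λ y → cases y (y ≟X x) (y ∈ˡ? xs)) ⟩
  ∑ elements (λ y → ⟦ y ∈ˡ? (x ∷ xs) ⟧) ∎
  where
  open ≤-Reasoning
  open DecMembership _≟X_ using () renaming (_∈?_ to _∈ˡ?_)
  cases : ∀ y (y≡x? : Dec (y ≡ x)) (y∈? : Dec (y ∈ˡ xs)) → ⟦ y≡x? ⟧ + ⟦ y∈? ⟧ ≤ ⟦ y ∈ˡ? (x ∷ xs) ⟧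
  cases y (yes refl) (yes y∈) = contradiction refl (All.lookup x∉xs y∈)
  cases y (yes eq) (no _) = ≤-reflexive (sym (⟦⟧-yes (y ∈ˡ? (x ∷ xs)) (Any.here eq)))
  cases y (no _) y∈? = ⟦⟧-mono y∈? (y ∈ˡ? (x ∷ xs)) Any.there

-- Given directly in lowest terms, so that its sign and its unnormalised form can be read off.
fromNat : ℕ → ℚ
fromNat k = mkℚ (ℤ.+ k) 0 (Coprimality.sym (1-coprimeTo k))

fromNat-+ : ∀ a b → fromNat (a + b) ≡ fromNat a ℚ.+ fromNat b
fromNat-+ a b = toℚᵘ-injective (ℚᵘ.≃-trans
  (*≡* (cong (ℤ._* ℤ.+ 1) (sym (cong₂ ℤ._+_ (ℤ.*-identityʳ (ℤ.+ a)) (ℤ.*-identityʳ (ℤ.+ b))))))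
  (ℚᵘ.≃-sym (toℚᵘ-homo-+ (fromNat a) (fromNat b))))

fromNat-∑ : ∀ {A : Set} (xs : List A) (g : A → ℕ) → sumℚ xs (fromNat ∘ g) ≡ fromNat (∑ xs g)
fromNat-∑ [] g = refl
fromNat-∑ (x ∷ xs) g = trans (cong (fromNat (g x) ℚ.+_) (fromNat-∑ xs g)) (sym (fromNat-+ (g x) (∑ xs g)))

fromNat≥0 : ∀ k → 0ℚ ℚ.≤ fromNat k
fromNat≥0 k = ℚ.nonNegative⁻¹ (fromNat k)

fromNat>0 : ∀ {k} → 0 < k → 0ℚ ℚ.< fromNat k
fromNat>0 {suc k} _ = ℚ.positive⁻¹ (fromNat (suc k))

module _ {n l : ℕ} where

  open FlowCounting (uniformFlow {n} {l})

  W≡level : ∀ r → W n l r ≡ level r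
  W≡level r = length-filter (λ x → rank x ≟ r) (elems n l)

  outflow>0 : ∀ {r} → 1 ≤ r → r < n ∸ l → 0 < outflow {n} {l} r
  outflow>0 {r} r≥1 r<d = *-mono-≤ (m<n⇒0<n∸m r+l<n) (≤-trans r≥1 (m≤m+n r l))
    where
    r+l<n : r + l < n
    r+l<n = m≤o∸n⇒m+n≤o (suc r) (<⇒≤ (m∸n≢0⇒n<m (>⇒≢ (≤-<-trans z≤n r<d)))) r<d

  inflow>0 : ∀ r → 1 ≤ r → 0 < inflow {n} {l} r
  inflow>0 r r≥1 = *-mono-≤ {1} {suc r + l} (s≤s z≤n) r≥1

  -- Write m for `r + l`. Once the smaller factor `n ∸ (suc r + l)` is raised to `g`, what remains
  -- is (m + 1)² r ≤ m (m + 2)(r + 1).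
  flow-ratio-decreasing : ∀ r → inflow {n} {l} r * outflow {n} {l} (suc r) ≤ outflow {n} {l} r * inflow {n} {l} (suc r)
  flow-ratio-decreasing r = begin
    (suc r + l) * r * ((n ∸ (suc r + l)) * (suc r + l))
      ≤⟨ *-monoʳ-≤ ((suc r + l) * r) (*-monoˡ-≤ (suc r + l) (∸-monoʳ-≤ n (n≤1+n (r + l)))) ⟩
    (suc r + l) * r * (g * (suc r + l))
      -- The added term is `g` times the difference m (m + 2)(r + 1) - (m + 1)² r = l + m + m².
      ≤⟨ m≤m+n _ (g * (l + (r + l) + (r + l) * (r + l))) ⟩
    (suc r + l) * r * (g * (suc r + l)) + g * (l + (r + l) + (r + l) * (r + l))
      ≡⟨ solve 3 (λ r l g → (con 1 :+ r :+ l) :* r :* (g :* (con 1 :+ r :+ l)) :+ g :* (l :+ (r :+ l) :+ (r :+ l) :* (r :+ l))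
                     := g :* (r :+ l) :* ((con 2 :+ r :+ l) :* (con 1 :+ r))) refl r l g ⟩
    g * (r + l) * ((suc (suc r) + l) * suc r) ∎
    where
    open ≤-Reasoning
    g : ℕ
    g = n ∸ (r + l)

  below-top : ∀ {r} → 1 ≤ r → r ≤ n ∸ l ∸ 1 → r < n ∸ l
  below-top {r} r≥1 r≤ with n ∸ l
  ... | zero = contradiction (≤-trans r≥1 r≤) (λ ())
  ... | suc m = s≤s r≤

  rankLogConcave : RankLogConcave n l
  rankLogConcave (suc r) (s≤s r≥1) 1+r≤
    rewrite W≡level r | W≡level (suc r) | W≡level (2 + r) =
    logConcave-at r (outflow>0 r≥1 (<-trans (n<1+n r) (below-top (s≤s z≤n) 1+r≤))) (inflow>0 (suc r) (s≤s z≤n)) (flow-ratio-decreasing r)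

  hasNormalizedFlow : HasNormalizedFlow n l
  hasNormalizedFlow = (λ x y → fromNat (flow x y)) , (λ x y → fromNat≥0 (flow x y)) , off-covers , uniform
    where
    off-covers : ∀ x y → ¬ (x ⋖ y) → fromNat (flow x y) ≡ 0ℚ
    off-covers x y not⋖ with flow-support x y
    ... | inj₁ eq = cong fromNat eq
    ... | inj₂ (e , s , arc) = contradiction (arc⇒⋖ {x = x} {y} arc) not⋖
    uniform : ∀ r → 1 ≤ r → r ≤ n ∸ l ∸ 1 →
      (Σ ℚ λ c → 0ℚ ℚ.< c × (∀ x → rank x ≡ r → sumℚ (elems n l) (λ y → fromNat (flow x y)) ≡ c)) ×
      (Σ ℚ λ c → 0ℚ ℚ.< c × (∀ y → rank y ≡ suc r → sumℚ (elems n l) (λ x → fromNat (flow x y)) ≡ c))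
    uniform r r≥1 r≤ =
      (fromNat (outflow {n} {l} r) , fromNat>0 (outflow>0 r≥1 (below-top r≥1 r≤)) ,
        λ { x refl → trans (fromNat-∑ (elems n l) (flow x)) (cong fromNat (flow-out x)) }) ,
      (fromNat (inflow {n} {l} r) , fromNat>0 (inflow>0 r r≥1) ,
        λ y eq → trans (fromNat-∑ (elems n l) (λ x → flow x y)) (cong fromNat (flow-in y eq)))

  -- The strong Sperner property

  _≟R_ : DecidableEquality (R n l)
  x ≟R y = map′ tuple-injective (cong tuple) (≡-dec (≡-dec Bool._≟_) (tuple x) (tuple y))

  open DecMembership _≟R_ using () renaming (_∈?_ to _∈ˡ?_)

  -- Only an inequality, because an element in both lists is counted twice on the right.
  levelIn-++ : ∀ xs ys r → levelIn (_∈ˡ? (xs ++ ys)) r ≤ levelIn (_∈ˡ? xs) r + levelIn (_∈ˡ? ys) r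
  levelIn-++ xs ys r = ≤-trans (∑-mono (elems n l) pointwise) (≤-reflexive (∑-+ (elems n l) _ _))
    where
    split : ∀ x (xs? : Dec (x ∈ˡ xs)) (ys? : Dec (x ∈ˡ ys)) → ⟦ x ∈ˡ? (xs ++ ys) ⟧ ≤ ⟦ xs? ⟧ + ⟦ ys? ⟧
    split x (yes _) ys? = ≤-trans (⟦⟧≤1 (x ∈ˡ? (xs ++ ys))) (m≤m+n 1 ⟦ ys? ⟧)
    split x (no x∉xs) ys? = ⟦⟧-mono (x ∈ˡ? (xs ++ ys)) ys? ([ (λ x∈ → contradiction x∈ x∉xs) , id ]′ ∘ ∈-++⁻ xs)
    pointwise : ∀ x → ⟦ rank x ≟ r ⟧ * ⟦ x ∈ˡ? (xs ++ ys) ⟧ ≤ ⟦ rank x ≟ r ⟧ * ⟦ x ∈ˡ? xs ⟧ + ⟦ rank x ≟ r ⟧ * ⟦ x ∈ˡ? ys ⟧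
    pointwise x = ≤-trans (*-monoʳ-≤ ⟦ rank x ≟ r ⟧ (split x (x ∈ˡ? xs) (x ∈ˡ? ys)))
      (≤-reflexive (*-distribˡ-+ ⟦ rank x ≟ r ⟧ ⟦ x ∈ˡ? xs ⟧ ⟦ x ∈ˡ? ys ⟧))

  ≤R-antisym : ∀ {x y : R n l} → x ≤R y → y ≤R x → x ≡ y
  ≤R-antisym {x} {y} x≤y y≤x = tuple-injective (≤R-antisym-tuple {x = x} {y} x≤y y≤x)

  -- Each antichain spends at most the total chain weight, and overlaps only lower the left side.
  antichains-lym : ∀ k {j} (As : Vec (List (R n l)) j) → (∀ i → Antichain (lookup As i)) →
    ∑ (upTo (suc k)) (λ i → coefficient k i * levelIn (_∈ˡ? concat (Vec.toList As)) (suc i)) ≤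
    j * (chainsBelow k * level (suc k))
  antichains-lym k [] _ = ≤-reflexive (∑-zero (upTo (suc k)) (λ i →
    trans (cong (coefficient k i *_) (∑-zero (elems n l) (λ x → *-zeroʳ ⟦ rank x ≟ suc i ⟧))) (*-zeroʳ (coefficient k i))))
  antichains-lym k (A ∷ As) antichain = begin
    ∑ (upTo (suc k)) (λ i → coefficient k i * levelIn (_∈ˡ? (A ++ rest)) (suc i))
      ≤⟨ ∑-mono (upTo (suc k)) (λ i → ≤-trans (*-monoʳ-≤ (coefficient k i) (levelIn-++ A rest (suc i)))
           (≤-reflexive (*-distribˡ-+ (coefficient k i) _ _))) ⟩
    ∑ (upTo (suc k)) (λ i → coefficient k i * levelIn (_∈ˡ? A) (suc i) + coefficient k i * levelIn (_∈ˡ? rest) (suc i))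
      ≡⟨ ∑-+ (upTo (suc k)) (λ i → coefficient k i * levelIn (_∈ˡ? A) (suc i)) (λ i → coefficient k i * levelIn (_∈ˡ? rest) (suc i)) ⟩
    ∑ (upTo (suc k)) (λ i → coefficient k i * levelIn (_∈ˡ? A) (suc i)) +
    ∑ (upTo (suc k)) (λ i → coefficient k i * levelIn (_∈ˡ? rest) (suc i))
      ≤⟨ +-mono-≤
           (LYM.lym (λ _ u∈ → u∈) (λ x≤y y≤z i u∈ → y≤z i (x≤y i u∈)) (λ {x} {y} → ≤R-antisym {x} {y}) (_∈ˡ? A) (antichain Fin.zero) k)
           (antichains-lym k As (antichain ∘ Fin.suc)) ⟩
    chainsBelow k * level (suc k) + _ ∎
    where
    open ≤-Reasoning
    rest : List (R n l)
    rest = concat (Vec.toList As)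

  -- Every element has exactly one rank from 1 to `n ∸ l`; index `i` stands for rank `suc (toℕ i)`.
  size-by-level : ∀ xs → ∑ (elems n l) (λ x → ⟦ x ∈ˡ? xs ⟧) ≡ ∑ (allFin (n ∸ l)) (λ i → levelIn (_∈ˡ? xs) (suc (toℕ i)))
  size-by-level xs = sym (begin
    ∑ (allFin (n ∸ l)) (λ i → levelIn (_∈ˡ? xs) (suc (toℕ i)))
      ≡⟨ ∑-swap (allFin (n ∸ l)) (elems n l) _ ⟩
    ∑ (elems n l) (λ x → ∑ (allFin (n ∸ l)) (λ i → ⟦ rank x ≟ suc (toℕ i) ⟧ * ⟦ x ∈ˡ? xs ⟧))
      ≡⟨ ∑-cong (elems n l) (λ x → ∑-*ʳ (allFin (n ∸ l)) ⟦ x ∈ˡ? xs ⟧ _) ⟩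
    ∑ (elems n l) (λ x → ∑ (allFin (n ∸ l)) (λ i → ⟦ rank x ≟ suc (toℕ i) ⟧) * ⟦ x ∈ˡ? xs ⟧)
      ≡⟨ ∑-cong (elems n l) (λ x → trans (cong (_* ⟦ x ∈ˡ? xs ⟧) (one x)) (*-identityˡ ⟦ x ∈ˡ? xs ⟧)) ⟩
    ∑ (elems n l) (λ x → ⟦ x ∈ˡ? xs ⟧) ∎)
    where
    open ≡-Reasoning
    at : ∀ r → 1 ≤ r → r ≤ n ∸ l → ∑ (allFin (n ∸ l)) (λ i → ⟦ r ≟ suc (toℕ i) ⟧) ≡ 1
    at (suc r) _ r<d = ∑-unique (λ i → suc r ≟ suc (toℕ i)) (allFin (n ∸ l)) (allFin-once (fromℕ< r<d))
      (cong suc (sym (toℕ-fromℕ< r<d)))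
      (λ i eq → toℕ-injective (trans (sym (suc-injective eq)) (sym (toℕ-fromℕ< r<d))))
    one : ∀ x → ∑ (allFin (n ∸ l)) (λ i → ⟦ rank x ≟ suc (toℕ i) ⟧) ≡ 1
    one x = at (rank x) (rank≥1 x) (rank≤n∸l x)

  unionSize≤ : ∀ {j} (As : Vec (List (R n l)) j) →
    unionSize As ≤ ∑ (allFin (n ∸ l)) (λ i → levelIn (_∈ˡ? concat (Vec.toList As)) (suc (toℕ i)))
  unionSize≤ As = begin
    length union
      ≤⟨ ∣unique∣≤∑ (elems n l) _≟R_ elems-once (AllPairs.map (λ tuples≢ → tuples≢ ∘ cong tuple) (deduplicate-! tuple-decSetoid (concat (Vec.toList As)))) ⟩
    ∑ (elems n l) (λ x → ⟦ x ∈ˡ? union ⟧)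
      ≤⟨ ∑-mono (elems n l) (λ x → ⟦⟧-mono (x ∈ˡ? union) (x ∈ˡ? concat (Vec.toList As)) (∈-deduplicate⁻ _ (concat (Vec.toList As)))) ⟩
    ∑ (elems n l) (λ x → ⟦ x ∈ˡ? concat (Vec.toList As) ⟧)
      ≡⟨ size-by-level (concat (Vec.toList As)) ⟩
    ∑ (allFin (n ∸ l)) (λ i → levelIn (_∈ˡ? concat (Vec.toList As)) (suc (toℕ i))) ∎
    where
    open ≤-Reasoning
    tuple-decSetoid : DecSetoid _ _
    tuple-decSetoid = On.decSetoid (decSetoid (≡-dec (≡-dec Bool._≟_))) (tuple {n} {l})
    union : List (R n l)
    union = deduplicate (λ x y → ≡-dec (≡-dec Bool._≟_) (tuple x) (tuple y)) (concat (Vec.toList As))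

  module _ {k : ℕ} (d≡ : n ∸ l ≡ suc k) where

    jSperner : ∀ j → j ≤ suc k → JSperner n l j
    jSperner j j≤d As antichain
      -- The cost of a level is the weight of the maximal chains through one of its elements, and
      -- the constant is the weight of all maximal chains; `antichains-lym` is the budget.
      with knapsack {suc k} (coefficient k ∘ toℕ) (λ i → levelIn (_∈ˡ? concat (Vec.toList As)) (suc (toℕ i)))
             (λ i → level (suc (toℕ i))) (chainsBelow k * level (suc k)) j j≤d
             (λ i → coefficient>0 inflow>0 k (toℕ i) (s≤s⁻¹ (toℕ<n i))
               (λ r r≥1 r≤k → outflow>0 r≥1 (subst (r <_) (sym d≡) (s≤s r≤k))))
             (λ i → levelIn≤level (_∈ˡ? concat (Vec.toList As)) (suc (toℕ i)))
             (λ i → coefficient-level k (toℕ i) (s≤s⁻¹ (toℕ<n i)))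
             (subst (_≤ j * (chainsBelow k * level (suc k))) (∑-upTo (suc k) _) (antichains-lym k As antichain))
    ... | v , refl , bound =
      (λ i → suc (toℕ (select v i))) ,
      (λ i → s≤s z≤n , subst (suc (toℕ (select v i)) ≤_) (sym d≡) (toℕ<n (select v i))) ,
      (λ a b a<b → s≤s (select-mono v a<b)) ,
      (begin
        unionSize As
          ≤⟨ unionSize≤ As ⟩
        ∑ (allFin (n ∸ l)) (λ i → levelIn (_∈ˡ? concat (Vec.toList As)) (suc (toℕ i)))
          ≡⟨ cong (λ m → ∑ (allFin m) (λ i → levelIn (_∈ˡ? concat (Vec.toList As)) (suc (toℕ i)))) d≡ ⟩
        ∑ (allFin (suc k)) (λ i → levelIn (_∈ˡ? concat (Vec.toList As)) (suc (toℕ i)))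
          ≤⟨ bound ⟩
        ∑ (allFin (suc k)) (restrict v (λ i → level (suc (toℕ i))))
          ≡⟨ sym (∑-select v (λ i → level (suc (toℕ i)))) ⟩
        Vec.sum (Vec.tabulate (λ i → level (suc (toℕ (select v i)))))
          ≡⟨ cong Vec.sum (tabulate-cong (λ i → sym (W≡level (suc (toℕ (select v i)))))) ⟩
        Vec.sum (Vec.tabulate (λ i → W n l (suc (toℕ (select v i))))) ∎)
      where open ≤-Reasoning

  stronglySperner : StronglySperner n l
  stronglySperner j j≥1 j≤d = cases (n ∸ l) refl
    where
    cases : ∀ m → n ∸ l ≡ m → JSperner n l j
    cases zero eq = contradiction (≤-trans j≥1 (subst (j ≤_) eq j≤d)) (λ ())
    cases (suc k) eq = jSperner eq j (subst (j ≤_) eq j≤d)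

theorem1p3 : (n l : ℕ) → l < n →
    RankLogConcave n l × HasNormalizedFlow n l × StronglySperner n l
theorem1p3 n l _ = rankLogConcave {n} {l} , hasNormalizedFlow {n} {l} , stronglySperner {n} {l}
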